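{- Let $\mathcal{C}$ be a finite abstract simplicial complex, let $\mathcal{V}=\{V_1,\ldots,V_n\}$ be a partition of $V(\mathcal{C})$, and let $m\ge 0$ be an integer. If $\eta_H(\mathcal{C}[V_I])\ge |I|+m$ for all nonempty $I\subseteq[n]$, where $V_I=\bigcup_{i\in I}V_i$, then $\eta_H(\mathbf{Col}(\mathcal{C},\mathcal{V}))\ge m+1$.
   Context: $\mathcal{C}[X]=\{\sigma\in\mathcal{C}:\sigma\subseteq X\}$. $\eta_H(\mathcal{K})$ is $2$ plus the largest $k\ge -2$ such that $\widetilde H_j(\mathcal{K};\mathbb{Q})=0$ for all $-1\le j\le k$ (where $\widetilde H_{ -1}=0$ means $\mathcal{K}$ has at least one vertex), possibly $\infty$. The colorful complex $\mathbf{Col}(\mathcal{C},\mathcal{V})$ is the simplicial complex whose vertices are the simplices $\sigma\in\mathcal{C}$ that contain at least one vertex of every class $V_i$, and whose simplices are the sets $\{\sigma_1,\ldots,\sigma_\ell\}$ of such simplices forming a chain $\sigma_1\subset\cdots\subset\sigma_\ell$. -}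

module Defs where

open import Algebra.Bundles using (CommutativeRing)
open import Data.Bool.Base using (true; false; if_then_else_)
open import Data.Fin.Base using (Fin; zero; suc)
open import Data.Fin.Properties using (any?; all?)
open import Data.Fin.Subset using (Subset; inside; outside; _∈_; _⊆_; _∩_; ⊥; ⁅_⁆; ∣_∣; ⋃; Nonempty)
open import Data.Fin.Subset.Properties using (_∈?_; _⊆?_; nonempty?; anySubset?; ∣p∣≤n; ⊆-trans; ⊥⊆; ∉⊥)
open import Data.List.Base using (List; []; _∷_; _++_; map; filter; length; lookup; allFin)
open import Data.Nat.Base as ℕ using (ℕ; zero; suc; s≤s)
import Data.Nat.Properties as ℕ
open import Data.Product.Base using (∃; _×_; _,_; proj₁; proj₂)
open import Data.Rational.Base using (ℚ; 0ℚ; 1ℚ; _+_; _*_; _-_; -_; 1/_; ≢-nonZero)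
import Data.Rational.Properties as ℚ
open import Data.Rational.Solver using (module +-*-Solver)
open import Data.Sum.Base using (_⊎_; inj₁; inj₂)
open import Data.Vec.Base using ([]; _∷_; _[_]≔_)
open import Function.Base using (_∘_; const)
open import Function.Bundles using (_⇔_)
open import Relation.Binary.PropositionalEquality using (_≡_; _≢_; _≗_; refl; sym; trans; cong; cong₂; subst; module ≡-Reasoning)
open import Relation.Nullary.Construct.Add.Supremum using (_⁺; ⊤⁺; [_])
open import Relation.Nullary.Decidable using (Dec; yes; no; does; _×-dec_; _⊎-dec_; _→-dec_; ¬?; map′; decidable-stable)
open import Relation.Nullary.Negation using (¬_; contradiction)
open import Relation.Unary using (Pred; Decidable)
open import Relation.Binary.Construct.Add.Supremum.NonStrict ℕ._≤_ public using () renaming (_≤⁺_ to _≤∞_)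
open import Algebra.Properties.Semiring.Sum (CommutativeRing.semiring ℚ.+-*-commutativeRing) using (sum; sum-cong-≗; ∑-distrib-+; *-distribˡ-sum)

------------------------------------------------------------------------
-- Complexes

-- Elements of Fin N need not be vertices.  The empty set is always a
-- face, so the complex without vertices is {∅}.
record Complex (N : ℕ) : Set₁ where
  field
    Face     : Pred (Subset N) _
    face?    : Decidable Face
    ∅-face   : Face ⊥
    ⊆-closed : ∀ {σ τ} → σ ⊆ τ → Face τ → Face σ

open Complex public

IsVertex : ∀ {N} → Complex N → Fin N → Set
IsVertex K v = Face K ⁅ v ⁆

infixl 9 _[[_]]

_[[_]] : ∀ {N} → Complex N → Subset N → Complex N
Face     (C [[ X ]]) σ               = Face C σ × σ ⊆ X
face?    (C [[ X ]]) σ               = face? C σ ×-dec σ ⊆? X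
∅-face   (C [[ X ]])                 = ∅-face C , ⊥⊆
⊆-closed (C [[ X ]]) σ⊆τ (Cτ , τ⊆X) = ⊆-closed C σ⊆τ Cτ , ⊆-trans σ⊆τ τ⊆X

record Partition {N : ℕ} (C : Complex N) (n : ℕ) : Set where
  field
    class    : Fin n → Subset N
    nonempty : ∀ i → Nonempty (class i)
    disjoint : ∀ {v i j} → v ∈ class i → v ∈ class j → i ≡ j
    covers   : ∀ v → IsVertex C v ⇔ ∃ λ i → v ∈ class i

open Partition public

⋃[_]_ : ∀ {N n} {C : Complex N} → Subset n → Partition C n → Subset N
⋃[ I ] V = ⋃ (map (class V) (filter (_∈? I) (allFin _)))

------------------------------------------------------------------------
-- The colorful complex

subsets : ∀ N → List (Subset N)
subsets zero    = [] ∷ []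
subsets (suc N) = map (outside ∷_) (subsets N) ++ map (inside ∷_) (subsets N)

Colorful : ∀ {N n} (C : Complex N) → Partition C n → Pred (Subset N) _
Colorful C V σ = Face C σ × (∀ i → Nonempty (σ ∩ class V i))

colorful? : ∀ {N n} (C : Complex N) (V : Partition C n) → Decidable (Colorful C V)
colorful? C V σ = face? C σ ×-dec all? (λ i → nonempty? (σ ∩ class V i))

-- Vertex i stands for the i-th member of the list (subsets and its sublists
-- have no repetitions); faces are the chains for inclusion.
orderComplex : ∀ {N} (σs : List (Subset N)) → Complex (length σs)
Face     (orderComplex σs) S =
  ∀ i → i ∈ S → ∀ j → j ∈ S → lookup σs i ⊆ lookup σs j ⊎ lookup σs j ⊆ lookup σs i
face?    (orderComplex σs) S =
  all? λ i → i ∈? S →-dec all? λ j → j ∈? S →-dec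
    (lookup σs i ⊆? lookup σs j ⊎-dec lookup σs j ⊆? lookup σs i)
∅-face   (orderComplex σs) i i∈⊥ = contradiction i∈⊥ ∉⊥
⊆-closed (orderComplex σs) S⊆T Tchain i i∈S j j∈S = Tchain i (S⊆T i∈S) j (S⊆T j∈S)

Col : ∀ {N n} (C : Complex N) (V : Partition C n) →
      Complex (length (filter (colorful? C V) (subsets N)))
Col {N} C V = orderComplex (filter (colorful? C V) (subsets N))

------------------------------------------------------------------------
-- Reduced rational homology

-- Each simplex is oriented by the order of Fin N.  All degrees are
-- shifted by one, so that they start at 0: a simplex of dimension j has
-- degree d = j + 1, its number of vertices.

IsSimplex : ∀ {N} → Complex N → ℕ → Pred (Subset N) _
IsSimplex K d σ = Face K σ × ∣ σ ∣ ≡ d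

IsChain : ∀ {N} → Complex N → ℕ → Pred (Subset N → ℚ) _
IsChain K d c = ∀ σ → ¬ IsSimplex K d σ → c σ ≡ 0ℚ

-- (-1) to the number of elements of τ below v.
sign : ∀ {N} → Fin N → Subset N → ℚ
sign zero    τ             = 1ℚ
sign (suc v) (outside ∷ τ) = sign v τ
sign (suc v) (inside  ∷ τ) = - sign v τ

-- The coefficient of τ in ∂c collects the contributions of the
-- simplices τ ∪ {v} with v ∉ τ.
∂ : ∀ {N} → (Subset N → ℚ) → (Subset N → ℚ)
∂ c τ = sum λ v → if does (v ∈? τ) then 0ℚ else sign v τ * c (τ [ v ]≔ inside)

-- H̃≡0 K d says that the reduced homology of K in dimension d - 1 is zero.
H̃≡0 : ∀ {N} → Complex N → ℕ → Set
H̃≡0 K zero    = ∃ (IsVertex K)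
H̃≡0 K (suc d) = ∀ z → IsChain K (suc d) z → ∂ z ≗ const 0ℚ →
                ∃ λ w → IsChain K (suc (suc d)) w × ∂ w ≗ z

-- With e = k + 2: the reduced homology of K vanishes in all dimensions
-- from -1 to k.
H̃≡0-below : ∀ {N} → Complex N → ℕ → Set
H̃≡0-below K e = ∀ d → d ℕ.< e → H̃≡0 K d

ℕ∞ : Set
ℕ∞ = ℕ ⁺

Isη : ∀ {N} → Complex N → ℕ∞ → Set
Isη K [ e ] = H̃≡0-below K e × (∀ e′ → H̃≡0-below K e′ → e′ ℕ.≤ e)
Isη K ⊤⁺    = ∀ e → H̃≡0-below K e

------------------------------------------------------------------------
-- Linear algebra over ℚ: vanishing of homology is decidable, whence
-- every complex has a value of η

open +-*-Solver using (solve; _:+_; _:*_; _:-_; _:=_; con)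

F : ℕ → Set
F N = Subset N → ℚ

private
  variable
    N M L : ℕ

record Linear (f : F N → F M) : Set where
  field
    resp : ∀ {x y} → x ≗ y → f x ≗ f y
    comb : ∀ a b x y → f (λ σ → a * x σ + b * y σ) ≗ λ τ → a * f x τ + b * f y τ

open Linear

module _ {f : F N → F M} (lf : Linear f) where

  linear-0 : f (const 0ℚ) ≗ const 0ℚ
  linear-0 τ = trans (comb lf 0ℚ 0ℚ (const 0ℚ) (const 0ℚ) τ)
    (solve 1 (λ u → con 0ℚ :* u :+ con 0ℚ :* u := con 0ℚ) refl (f (const 0ℚ) τ))

  linear-+ : ∀ x y → f (λ σ → x σ + y σ) ≗ λ τ → f x τ + f y τ
  linear-+ x y τ =
    trans (resp lf (λ σ → solve 2 (λ u v → u :+ v := con 1ℚ :* u :+ con 1ℚ :* v) refl (x σ) (y σ)) τ)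
    (trans (comb lf 1ℚ 1ℚ x y τ)
      (solve 2 (λ u v → con 1ℚ :* u :+ con 1ℚ :* v := u :+ v) refl (f x τ) (f y τ)))

  linear-∸ : ∀ x y → f (λ σ → x σ - y σ) ≗ λ τ → f x τ - f y τ
  linear-∸ x y τ =
    trans (resp lf (λ σ → solve 2 (λ u v → u :- v := con 1ℚ :* u :+ con (- 1ℚ) :* v) refl (x σ) (y σ)) τ)
    (trans (comb lf 1ℚ (- 1ℚ) x y τ)
      (solve 2 (λ u v → con 1ℚ :* u :+ con (- 1ℚ) :* v := u :- v) refl (f x τ) (f y τ)))

  linear-* : ∀ a x → f (λ σ → a * x σ) ≗ λ τ → a * f x τ
  linear-* a x τ =
    trans (resp lf (λ σ → solve 2 (λ c u → c :* u := c :* u :+ con 0ℚ :* u) refl a (x σ)) τ)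
    (trans (comb lf a 0ℚ x x τ)
      (solve 2 (λ c u → c :* u :+ con 0ℚ :* u := c :* u) refl a (f x τ)))

∘-linear : {g : F M → F L} {f : F N → F M} → Linear g → Linear f → Linear (g ∘ f)
resp (∘-linear lg lf) x≗y       = resp lg (resp lf x≗y)
comb (∘-linear {g = g} {f} lg lf) a b x y τ =
  trans (resp lg (comb lf a b x y) τ) (comb lg a b (f x) (f y) τ)

id-linear : Linear {N} (λ x → x)
resp id-linear x≗y         = x≗y
comb id-linear a b x y τ = refl

0-linear : Linear {N} {M} (λ _ → const 0ℚ)
resp 0-linear x≗y         τ = refl
comb 0-linear a b x y τ =
  solve 2 (λ c d → con 0ℚ := c :* con 0ℚ :+ d :* con 0ℚ) refl a b

∸-linear : {f g : F N → F M} → Linear f → Linear g → Linear (λ x σ → f x σ - g x σ)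
resp (∸-linear lf lg) x≗y τ = cong₂ _-_ (resp lf x≗y τ) (resp lg x≗y τ)
comb (∸-linear {f = f} {g} lf lg) a b x y τ =
  trans (cong₂ _-_ (comb lf a b x y τ) (comb lg a b x y τ))
    (solve 6 (λ c d p q r s →
        (c :* p :+ d :* q) :- (c :* r :+ d :* s) := c :* (p :- r) :+ d :* (q :- s))
      refl a b (f x τ) (f y τ) (g x τ) (g y τ))

join : F N → F N → F (suc N)
join x y (outside ∷ σ) = x σ
join x y (inside  ∷ σ) = y σ

join-linear : {f g : F M → F N} → Linear f → Linear g → Linear (λ x → join (f x) (g x))
resp (join-linear lf lg) x≗y (outside ∷ σ) = resp lf x≗y σ
resp (join-linear lf lg) x≗y (inside  ∷ σ) = resp lg x≗y σ
comb (join-linear lf lg) a b x y (outside ∷ σ) = comb lf a b x y σ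
comb (join-linear lf lg) a b x y (inside  ∷ σ) = comb lg a b x y σ

ιₒ ιᵢ : F N → F (suc N)
ιₒ x = join x (const 0ℚ)
ιᵢ x = join (const 0ℚ) x

split : {f : F (suc N) → F M} → Linear f → ∀ z →
        f z ≗ λ τ → f (ιₒ (z ∘ (outside ∷_))) τ + f (ιᵢ (z ∘ (inside ∷_))) τ
split lf z τ = trans
  (resp lf (λ { (outside ∷ σ) → sym (ℚ.+-identityʳ _)
              ; (inside  ∷ σ) → sym (ℚ.+-identityˡ _) }) τ)
  (linear-+ lf (ιₒ (z ∘ (outside ∷_))) (ιᵢ (z ∘ (inside ∷_))) τ)

scalar : {f : F 0 → F M} → Linear f → ∀ x → f x ≗ λ τ → x [] * f (const 1ℚ) τ
scalar lf x τ = trans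
  (resp lf (λ { [] → sym (ℚ.*-identityʳ (x [])) }) τ)
  (linear-* lf (x []) (const 1ℚ) τ)

nonzero? : (x : F N) → Dec (∃ λ σ → x σ ≢ 0ℚ)
nonzero? x = anySubset? (λ σ → ¬? (x σ ℚ.≟ 0ℚ))

≗0 : (x : F N) → ¬ (∃ λ σ → x σ ≢ 0ℚ) → x ≗ const 0ℚ
≗0 x ¬∃ σ = decidable-stable (x σ ℚ.≟ 0ℚ) (λ xσ≢0 → ¬∃ (σ , xσ≢0))

zero? : ∀ {N M} {f : F N → F M} → Linear f → Dec (∀ x → f x ≗ const 0ℚ)
zero? {zero} {f = f} lf with nonzero? (f (const 1ℚ))
... | yes (τ , ≢0) = no λ f≗0 → ≢0 (f≗0 (const 1ℚ) τ)
... | no  ¬∃       = yes λ x τ →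
      trans (scalar lf x τ) (trans (cong (x [] *_) (≗0 _ ¬∃ τ)) (ℚ.*-zeroʳ (x [])))
zero? {suc N} {f = f} lf = map′
  (λ { (p , q) x τ → trans (split lf x τ)
         (trans (cong₂ _+_ (p (x ∘ (outside ∷_)) τ) (q (x ∘ (inside ∷_)) τ)) (ℚ.+-identityˡ 0ℚ)) })
  (λ f≗0 → (λ x → f≗0 (ιₒ x)) , (λ x → f≗0 (ιᵢ x)))
  (zero? (∘-linear lf (join-linear id-linear 0-linear)) ×-dec
   zero? (∘-linear lf (join-linear 0-linear id-linear)))

GeneralizedInverse : (F N → F M) → Set
GeneralizedInverse f = ∃ λ g → Linear g × (∀ x → f (g (f x)) ≗ f x)

generalizedInverse : ∀ {N M} {f : F N → F M} → Linear f → GeneralizedInverse f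
generalizedInverse {zero} {f = f} lf with nonzero? (f (const 1ℚ))
... | no  ¬∃ = (λ _ → const 0ℚ) , 0-linear , λ x τ →
      trans (linear-0 lf τ)
        (sym (trans (scalar lf x τ) (trans (cong (x [] *_) (≗0 _ ¬∃ τ)) (ℚ.*-zeroʳ (x [])))))
... | yes (σ , a≢0) = g , lg , fgf
  where
  a = f (const 1ℚ) σ
  instance _ = ≢-nonZero a≢0
  g : F _ → F 0
  g y _ = y σ * 1/ a
  lg : Linear g
  resp lg x≗y _ = cong (_* 1/ a) (x≗y σ)
  comb lg b c x y _ =
    solve 5 (λ b c u v i → (b :* u :+ c :* v) :* i := b :* (u :* i) :+ c :* (v :* i))
      refl b c (x σ) (y σ) (1/ a)
  fgf : ∀ x → f (g (f x)) ≗ f x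
  fgf x τ = begin
    f (g (f x)) τ                               ≡⟨ scalar lf (g (f x)) τ ⟩
    (f x σ * 1/ a) * f (const 1ℚ) τ             ≡⟨ cong (λ u → (u * 1/ a) * f (const 1ℚ) τ) (scalar lf x σ) ⟩
    ((x [] * a) * 1/ a) * f (const 1ℚ) τ        ≡⟨ cong (_* f (const 1ℚ) τ) (ℚ.*-assoc (x []) a (1/ a)) ⟩
    (x [] * (a * 1/ a)) * f (const 1ℚ) τ        ≡⟨ cong (λ u → (x [] * u) * f (const 1ℚ) τ) (ℚ.*-inverseʳ a) ⟩
    (x [] * 1ℚ) * f (const 1ℚ) τ                ≡⟨ cong (_* f (const 1ℚ) τ) (ℚ.*-identityʳ (x [])) ⟩
    x [] * f (const 1ℚ) τ                       ≡⟨ scalar lf x τ ⟨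
    f x τ                                       ∎
    where open ≡-Reasoning
generalizedInverse {suc N} {M} {f} lf = g , lg , fgf
  where
  f₁ f₂ f₂′ : F N → F M
  f₁ = f ∘ ιₒ
  f₂ = f ∘ ιᵢ
  l₁ : Linear f₁
  l₁ = ∘-linear lf (join-linear id-linear 0-linear)
  l₂ : Linear f₂
  l₂ = ∘-linear lf (join-linear 0-linear id-linear)
  inv₁ = generalizedInverse l₁
  g₁ = proj₁ inv₁
  P u : F M → F M
  u = f₁ ∘ g₁
  lu : Linear u
  lu = ∘-linear l₁ (proj₁ (proj₂ inv₁))
  P y σ = y σ - u y σ
  lP : Linear P
  lP = ∸-linear id-linear lu
  f₂′ = P ∘ f₂
  inv₂ = generalizedInverse (∘-linear lP l₂)
  g₂ = proj₁ inv₂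
  t : F M → F N
  t = g₂ ∘ P
  lt : Linear t
  lt = ∘-linear (proj₁ (proj₂ inv₂)) lP
  s : F M → F M
  s y σ = y σ - f₂ (t y) σ
  ls : Linear s
  ls = ∸-linear id-linear (∘-linear l₂ lt)
  g : F M → F (suc N)
  g y = join (g₁ (s y)) (t y)
  lg : Linear g
  lg = join-linear (∘-linear (proj₁ (proj₂ inv₁)) ls) lt
  fgf : ∀ x → f (g (f x)) ≗ f x
  fgf x τ = begin
    f (g y) τ                                      ≡⟨ split lf (g y) τ ⟩
    u (s y) τ + f₂ (t y) τ                         ≡⟨ cong (_+ f₂ (t y) τ) (linear-∸ lu y (f₂ (t y)) τ) ⟩
    (u y τ - u (f₂ (t y)) τ) + f₂ (t y) τ          ≡⟨ solve 3 (λ p q r → (p :- q) :+ r := p :+ (r :- q)) refl (u y τ) (u (f₂ (t y)) τ) (f₂ (t y) τ) ⟩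
    u y τ + f₂′ (t y) τ                            ≡⟨ cong (u y τ +_) f₂′t ⟩
    u y τ + P y τ                                  ≡⟨ solve 2 (λ p q → p :+ (q :- p) := q) refl (u y τ) (y τ) ⟩
    y τ                                            ∎
    where
    open ≡-Reasoning
    y = f x
    x₁ = x ∘ (outside ∷_)
    x₂ = x ∘ (inside ∷_)
    Py : P y ≗ f₂′ x₂
    Py σ = begin
      y σ - u y σ
        ≡⟨ cong₂ _-_ (split lf x σ) (trans (resp lu (split lf x) σ) (linear-+ lu (f₁ x₁) (f₂ x₂) σ)) ⟩
      (f₁ x₁ σ + f₂ x₂ σ) - (u (f₁ x₁) σ + u (f₂ x₂) σ)
        ≡⟨ cong (λ q → (f₁ x₁ σ + f₂ x₂ σ) - (q + u (f₂ x₂) σ)) (proj₂ (proj₂ inv₁) x₁ σ) ⟩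
      (f₁ x₁ σ + f₂ x₂ σ) - (f₁ x₁ σ + u (f₂ x₂) σ)
        ≡⟨ solve 3 (λ p q r → (p :+ q) :- (p :+ r) := q :- r) refl (f₁ x₁ σ) (f₂ x₂ σ) (u (f₂ x₂) σ) ⟩
      f₂ x₂ σ - u (f₂ x₂) σ ∎
    l₂′ : Linear f₂′
    l₂′ = ∘-linear lP l₂
    f₂′t : f₂′ (t y) τ ≡ P y τ
    f₂′t = begin
      f₂′ (g₂ (P y)) τ      ≡⟨ resp l₂′ (resp (proj₁ (proj₂ inv₂)) Py) τ ⟩
      f₂′ (g₂ (f₂′ x₂)) τ   ≡⟨ proj₂ (proj₂ inv₂) x₂ τ ⟩
      f₂′ x₂ τ              ≡⟨ Py τ ⟨
      P y τ                 ∎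

∂-linear : Linear (∂ {N})
resp ∂-linear {x} {y} x≗y τ = sum-cong-≗ eq
  where
  term : F _ → Fin _ → ℚ
  term z v = if does (v ∈? τ) then 0ℚ else sign v τ * z (τ [ v ]≔ inside)
  eq : ∀ v → term x v ≡ term y v
  eq v with does (v ∈? τ)
  ... | true  = refl
  ... | false = cong (sign v τ *_) (x≗y (τ [ v ]≔ inside))
comb ∂-linear a b x y τ = begin
  ∂ (λ σ → a * x σ + b * y σ) τ              ≡⟨ sum-cong-≗ eq ⟩
  sum (λ v → a * term x v + b * term y v)    ≡⟨ ∑-distrib-+ (λ v → a * term x v) (λ v → b * term y v) ⟩
  sum (λ v → a * term x v) + sum (λ v → b * term y v)
    ≡⟨ cong₂ _+_ (*-distribˡ-sum a (term x)) (*-distribˡ-sum b (term y)) ⟨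
  a * ∂ x τ + b * ∂ y τ                      ∎
  where
  open ≡-Reasoning
  term : F _ → Fin _ → ℚ
  term z v = if does (v ∈? τ) then 0ℚ else sign v τ * z (τ [ v ]≔ inside)
  eq : ∀ v → term (λ σ → a * x σ + b * y σ) v ≡ a * term x v + b * term y v
  eq v with does (v ∈? τ)
  ... | true  = solve 2 (λ c d → con 0ℚ := c :* con 0ℚ :+ d :* con 0ℚ) refl a b
  ... | false = solve 5 (λ c d e p q → e :* (c :* p :+ d :* q) := c :* (e :* p) :+ d :* (e :* q))
                  refl a b (sign v τ) (x (τ [ v ]≔ inside)) (y (τ [ v ]≔ inside))

if-no : {P : Set} (P? : Dec P) {q : ℚ} → ¬ P → (if does P? then q else 0ℚ) ≡ 0ℚ
if-no (yes p) ¬p = contradiction p ¬p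
if-no (no _)  _  = refl

if-id : {P : Set} (P? : Dec P) {q : ℚ} → (¬ P → q ≡ 0ℚ) → (if does P? then q else 0ℚ) ≡ q
if-id (yes _) _   = refl
if-id (no ¬p) q≡0 = sym (q≡0 ¬p)

module _ (K : Complex N) where

  isSimplex? : ∀ d → Decidable (IsSimplex K d)
  isSimplex? d σ = face? K σ ×-dec ∣ σ ∣ ℕ.≟ d

  restrict : ℕ → F N → F N
  restrict d x σ = if does (isSimplex? d σ) then x σ else 0ℚ

  restrict-linear : ∀ d → Linear (restrict d)
  resp (restrict-linear d) x≗y σ with does (isSimplex? d σ)
  ... | true  = x≗y σ
  ... | false = refl
  comb (restrict-linear d) a b x y σ with does (isSimplex? d σ)
  ... | true  = refl
  ... | false = solve 2 (λ c d → con 0ℚ := c :* con 0ℚ :+ d :* con 0ℚ) refl a b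

  restrict-chain : ∀ d x → IsChain K d (restrict d x)
  restrict-chain d x σ = if-no (isSimplex? d σ)

  restrict-id : ∀ d {x} → IsChain K d x → restrict d x ≗ x
  restrict-id d cx σ = if-id (isSimplex? d σ) (cx σ)

  H̃≡0? : ∀ d → Dec (H̃≡0 K d)
  H̃≡0? zero    = any? (λ v → face? K ⁅ v ⁆)
  H̃≡0? (suc d) = map′ to from (zero? lT)
    where
    open ≡-Reasoning
    A A′ T : F N → F N
    A  = ∂ ∘ restrict (suc d)
    A′ = ∂ ∘ restrict (suc (suc d))
    lA : Linear A
    lA = ∘-linear ∂-linear (restrict-linear (suc d))
    lA′ : Linear A′
    lA′ = ∘-linear ∂-linear (restrict-linear (suc (suc d)))
    inv  = generalizedInverse lA
    inv′ = generalizedInverse lA′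
    B  = proj₁ inv
    B′ = proj₁ inv′
    lB  = proj₁ (proj₂ inv)
    lB′ = proj₁ (proj₂ inv′)
    -- Q maps onto the space of cycles and fixes every cycle.
    Q : F N → F N
    Q x = restrict (suc d) (λ σ → x σ - B (A x) σ)
    lQ : Linear Q
    lQ = ∘-linear (restrict-linear (suc d)) (∸-linear id-linear (∘-linear lB lA))
    T x σ = A′ (B′ (Q x)) σ - Q x σ
    lT : Linear T
    lT = ∸-linear (∘-linear lA′ (∘-linear lB′ lQ)) lQ
    x-x : ∀ q → q - q ≡ 0ℚ
    x-x = ℚ.+-inverseʳ
    to : (∀ x → T x ≗ const 0ℚ) → H̃≡0 K (suc d)
    to T≗0 z cz ∂z≗0 = restrict (suc (suc d)) (B′ z) , restrict-chain (suc (suc d)) (B′ z) , λ τ → begin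
      A′ (B′ z) τ                 ≡⟨ resp lA′ (resp lB′ Qz) τ ⟨
      A′ (B′ (Q z)) τ             ≡⟨ solve 2 (λ p q → p := (p :- q) :+ q) refl (A′ (B′ (Q z)) τ) (Q z τ) ⟩
      T z τ + Q z τ               ≡⟨ cong₂ _+_ (T≗0 z τ) (Qz τ) ⟩
      0ℚ + z τ                    ≡⟨ ℚ.+-identityˡ (z τ) ⟩
      z τ                         ∎
      where
      Az : A z ≗ const 0ℚ
      Az τ = trans (resp ∂-linear (restrict-id (suc d) cz) τ) (∂z≗0 τ)
      z-BAz : (λ σ → z σ - B (A z) σ) ≗ z
      z-BAz σ = trans (cong (λ q → z σ - q) (trans (resp lB Az σ) (linear-0 lB σ))) (solve 1 (λ p → p :- con 0ℚ := p) refl (z σ))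
      Qz : Q z ≗ z
      Qz σ = trans (resp (restrict-linear (suc d)) z-BAz σ) (restrict-id (suc d) cz σ)
    from : H̃≡0 K (suc d) → ∀ x → T x ≗ const 0ℚ
    from H x τ = begin
      A′ (B′ (Q x)) τ - Q x τ       ≡⟨ cong₂ _-_ (resp lA′ (resp lB′ A′w) τ) (A′w τ) ⟨
      A′ (B′ (A′ w)) τ - A′ w τ     ≡⟨ cong (_- A′ w τ) (proj₂ (proj₂ inv′) w τ) ⟩
      A′ w τ - A′ w τ               ≡⟨ x-x (A′ w τ) ⟩
      0ℚ                            ∎
      where
      ∂Q : ∂ (Q x) ≗ const 0ℚ
      ∂Q σ = trans (linear-∸ lA x (B (A x)) σ)
        (trans (cong (λ q → A x σ - q) (proj₂ (proj₂ inv) x σ)) (x-x (A x σ)))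
      Hx = H (Q x) (restrict-chain (suc d) _) ∂Q
      w = proj₁ Hx
      A′w : A′ w ≗ Q x
      A′w σ = trans (resp ∂-linear (restrict-id (suc (suc d)) (proj₁ (proj₂ Hx))) σ) (proj₂ (proj₂ Hx) σ)

  H̃≡0-above : ∀ d → N ℕ.< d → H̃≡0 K d
  H̃≡0-above (suc d) N<d z cz _ =
    const 0ℚ , (λ _ _ → refl) , λ τ → trans (linear-0 ∂-linear τ)
      (sym (cz τ λ { (_ , ∣τ∣≡d) → ℕ.<⇒≱ N<d (subst (ℕ._≤ N) ∣τ∣≡d (∣p∣≤n τ)) }))

  H̃≡0-below-suc : ∀ {e} → H̃≡0-below K e → H̃≡0 K e → H̃≡0-below K (suc e)
  H̃≡0-below-suc {e} below He d (s≤s d≤e) with ℕ.m≤n⇒m<n∨m≡n d≤e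
  ... | inj₁ d<e  = below d d<e
  ... | inj₂ refl = He

  η-exists : ∃ (Isη K)
  η-exists = search (suc N) 0 (ℕ.≤-reflexive (sym (ℕ.+-identityʳ (suc N)))) (λ _ ())
    where
    search : ∀ fuel e → N ℕ.< fuel ℕ.+ e → H̃≡0-below K e → ∃ (Isη K)
    search zero e N<e below = ⊤⁺ , λ _ d _ → all d
      where
      all : ∀ d → H̃≡0 K d
      all d with d ℕ.<? e
      ... | yes d<e = below d d<e
      ... | no  d≮e = H̃≡0-above d (ℕ.<-≤-trans N<e (ℕ.≮⇒≥ d≮e))
    search (suc fuel) e N<fuel+e below with H̃≡0? e
    ... | yes He = search fuel (suc e) (subst (N ℕ.<_) (sym (ℕ.+-suc fuel e)) N<fuel+e) (H̃≡0-below-suc below He)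
    ... | no ¬He = [ e ] , below , λ e′ below′ → ℕ.≮⇒≥ (λ e<e′ → ¬He (below′ e e<e′))

ηH : Complex N → ℕ∞
ηH K = proj₁ (η-exists K)

ηH-isη : (K : Complex N) → Isη K (ηH K)
ηH-isη K = proj₂ (η-exists K)

{-# OPTIONS --safe #-}

-- Let R be the complex of simplicial chains of C modulo those supported on
-- non-colorful simplices.  Filtering by the colors that are required to
-- occur, one color at a time, long exact sequences turn the hypothesis into
-- the vanishing of the homology of R in low degrees, except for one copy of ℚ
-- at n vertices, which an augmentation ε (an iterated connecting
-- homomorphism) kills.  The colorful simplices are the cells of a regular
-- cell complex (σ is the product of its monochromatic parts) with cellular
-- chain complex R and barycentric subdivision Col.  The subdivision map Φ
-- sends a cell to the cone, with apex its barycenter, over the image of its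
-- boundary.  The mapping cone of Φ is exact over every down-closed set of
-- cells, by Mayer-Vietoris induction on that set: over the cells below a
-- single cell, the augmented R is exact by the first part applied to a
-- simplex, and the subdivision is a cone.
module Submission where

open import Defs
open import Algebra.Bundles using (CommutativeRing)
open import Data.Bool.Base using (true; false; if_then_else_)
import Data.Bool.Properties as Bool
open import Data.Fin.Base using (Fin; zero; suc)
import Data.Fin.Properties as Fin
open import Data.Fin.Subset using (Subset; inside; outside; _∈_; _∉_; _⊆_; _∩_; ⊥; ⊤; ⁅_⁆; ∣_∣; ⋃; Nonempty; Empty) renaming (_-_ to _∖_)
open import Data.Fin.Subset.Properties
open import Data.List.Base using (List; []; _∷_; map; filter; length; lookup; allFin)
open import Data.List.Membership.Propositional using () renaming (_∈_ to _∈ˡ_)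
open import Data.List.Membership.Propositional.Properties using (∈-filter⁺; ∈-filter⁻; ∈-allFin; ∈-lookup; ∈-map⁺; ∈-map⁻; ∈-++⁺ˡ; ∈-++⁺ʳ)
open import Data.List.Relation.Unary.All as All using (All; []; _∷_)
open import Data.List.Relation.Unary.AllPairs using ([]; _∷_)
open import Data.List.Relation.Unary.Any as Any using (here; there)
open import Data.List.Relation.Unary.Any.Properties using (lookup-index)
open import Data.List.Relation.Unary.Unique.Propositional using (Unique)
import Data.List.Relation.Unary.Unique.Propositional.Properties as Unique
open import Data.Nat.Base as ℕ using (ℕ; zero; suc; s≤s; z≤n)
import Data.Nat.Properties as ℕ
open import Data.Product.Base using (∃; _×_; _,_; proj₁; proj₂)
open import Data.Rational.Base using (ℚ; 0ℚ; 1ℚ; _+_; _*_; _-_; -_)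
import Data.Rational.Properties as ℚ
open import Data.Rational.Solver using (module +-*-Solver)
open import Data.Sum.Base using (_⊎_; inj₁; inj₂; [_,_]′)
open import Data.Unit.Base as Unit using (tt)
open import Data.Vec.Base using ([]; _∷_; _[_]≔_; here; there; tabulate)
open import Data.Vec.Properties using (≡-dec; ∷-injectiveʳ; lookup∘tabulate; []=⇒lookup; lookup⇒[]=; []≔-updates)
open import Function.Base using (_∘_; const; id)
open import Function.Bundles using (Equivalence)
open import Level using (0ℓ)
open import Relation.Binary.PropositionalEquality using (_≡_; _≢_; _≗_; refl; sym; trans; cong; cong₂; subst; module ≡-Reasoning)
open import Relation.Nullary.Construct.Add.Supremum using ([_]; ⊤⁺)
open import Relation.Nullary.Decidable using (Dec; yes; no; does; decidable-stable; _×-dec_; dec-true)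
open import Relation.Nullary.Negation using (¬_; contradiction)
open import Relation.Unary using (Pred; Decidable)
open import Algebra.Properties.Semiring.Sum (CommutativeRing.semiring ℚ.+-*-commutativeRing) using (sum; sum-cong-≗; ∑-distrib-+; *-distribˡ-sum; sum-replicate-zero)
open import Relation.Binary.Construct.Add.Supremum.NonStrict ℕ._≤_ using (_≤⊤⁺; [_])
open +-*-Solver using (solve; _:+_; _:*_; _:-_; :-_; _:=_; con)
open Linear
open ≡-Reasoning

private
  variable
    N M L : ℕ

-- Rational functions on a finite set and their supports.

infixl 6 _⊕_ _⊖_

_⊕_ _⊖_ : {A : Set} → (A → ℚ) → (A → ℚ) → (A → ℚ)
(x ⊕ y) σ = x σ + y σ
(x ⊖ y) σ = x σ - y σ

𝟎 : {A : Set} → A → ℚ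
𝟎 = const 0ℚ

-- `Supp (IsSimplex K d)` unfolds to `IsChain K d`, so the support lemmas below apply to chains
-- directly.
Supp : Pred (Subset N) 0ℓ → Pred (F N) 0ℓ
Supp P x = ∀ σ → ¬ P σ → x σ ≡ 0ℚ

module _ {P : Pred (Subset N) 0ℓ} where

  supp-mono : ∀ {Q : Pred (Subset N) 0ℓ} {x} → (∀ {σ} → P σ → Q σ) → Supp P x → Supp Q x
  supp-mono P⇒Q sx σ ¬Q = sx σ (¬Q ∘ P⇒Q)

  supp-resp : ∀ {x y} → x ≗ y → Supp P x → Supp P y
  supp-resp x≗y sx σ ¬P = trans (sym (x≗y σ)) (sx σ ¬P)

  supp-⊕ : ∀ {x y} → Supp P x → Supp P y → Supp P (x ⊕ y)
  supp-⊕ sx sy σ ¬P = cong₂ _+_ (sx σ ¬P) (sy σ ¬P)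

  supp-⊖ : ∀ {x y} → Supp P x → Supp P y → Supp P (x ⊖ y)
  supp-⊖ sx sy σ ¬P = cong₂ _-_ (sx σ ¬P) (sy σ ¬P)

  supp-* : ∀ {x} a → Supp P x → Supp P (λ σ → a * x σ)
  supp-* a sx σ ¬P = trans (cong (a *_) (sx σ ¬P)) (ℚ.*-zeroʳ a)

  supp-𝟎 : Supp P 𝟎
  supp-𝟎 σ ¬P = refl

  -- The predicates may be undecidable: equality with zero in ℚ is decidable, and this removes the
  -- double negation.
  supp-∩ : ∀ {Q R : Pred (Subset N) 0ℓ} {x} → (∀ {σ} → P σ → Q σ → R σ) → Supp P x → Supp Q x → Supp R x
  supp-∩ {x = x} PQ⇒R sx sx′ σ ¬R = decidable-stable (x σ ℚ.≟ 0ℚ) λ x≢0 →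
    x≢0 (sx σ λ p → x≢0 (sx′ σ (¬R ∘ PQ⇒R p)))

  keep : Decidable P → F N → F N
  keep P? x σ = if does (P? σ) then x σ else 0ℚ

  module _ (P? : Decidable P) where

    keep-yes : ∀ x σ → P σ → keep P? x σ ≡ x σ
    keep-yes x σ p = if-id (P? σ) (contradiction p)

    keep-supp : ∀ x → Supp P (keep P? x)
    keep-supp x σ = if-no (P? σ)

    keep-≗ : ∀ {x y} → Supp P y → (∀ σ → P σ → x σ ≡ y σ) → keep P? x ≗ y
    keep-≗ sy x≡y σ with P? σ
    ... | yes p = x≡y σ p
    ... | no ¬p = sym (sy σ ¬p)

    keep-supp-∩ : ∀ {Q R : Pred (Subset N) 0ℓ} {x} → (∀ {σ} → P σ → Q σ → R σ) → Supp Q x → Supp R (keep P? x)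
    keep-supp-∩ {x = x} PQ⇒R sx σ ¬R with P? σ
    ... | yes p = sx σ (¬R ∘ PQ⇒R p)
    ... | no  _ = refl

    drop-supp-∩ : ∀ {Q R : Pred (Subset N) 0ℓ} {x} → (∀ {σ} → ¬ P σ → Q σ → R σ) → Supp Q x → Supp R (x ⊖ keep P? x)
    drop-supp-∩ {x = x} PQ⇒R sx σ ¬R with P? σ
    ... | yes _ = ℚ.+-inverseʳ (x σ)
    ... | no ¬p = cong (_- 0ℚ) (sx σ (¬R ∘ PQ⇒R ¬p))

    keep-linear : Linear (keep P?)
    resp keep-linear x≗y σ with does (P? σ)
    ... | true  = x≗y σ
    ... | false = refl
    comb keep-linear a b x y σ with does (P? σ)
    ... | true  = refl
    ... | false = solve 2 (λ c d → con 0ℚ := c :* con 0ℚ :+ d :* con 0ℚ) refl a b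

-- Point masses, finite sums and linear maps.

_≟ˢ_ : (σ τ : Subset N) → Dec (σ ≡ τ)
_≟ˢ_ = ≡-dec Bool._≟_

atom : Subset N → ℚ → F N
atom τ q = keep (_≟ˢ τ) (const q)

atom-at : ∀ (τ : Subset N) q → atom τ q τ ≡ q
atom-at τ q = keep-yes (_≟ˢ τ) (const q) τ refl

atom-supp : ∀ (τ : Subset N) q → Supp (_≡ τ) (atom τ q)
atom-supp τ q = keep-supp (_≟ˢ τ) (const q)

atom-≗ : ∀ {τ : Subset N} {x} → Supp (_≡ τ) x → atom τ (x τ) ≗ x
atom-≗ {τ = τ} sx = keep-≗ (_≟ˢ τ) sx λ { σ refl → refl }

atom-neg : ∀ (τ : Subset N) q σ → atom τ (- q) σ ≡ - atom τ q σ
atom-neg τ q σ with does (σ ≟ˢ τ)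
... | true  = refl
... | false = refl

sum-zero : ∀ {k} (f : Fin k → ℚ) → (∀ i → f i ≡ 0ℚ) → sum f ≡ 0ℚ
sum-zero {k} f f≡0 = trans (sum-cong-≗ f≡0) (sum-replicate-zero k)

sum-single : ∀ {k} (f : Fin k → ℚ) j → (∀ i → i ≢ j → f i ≡ 0ℚ) → sum f ≡ f j
sum-single f zero    f≡0 = trans (cong (f zero +_) (sum-zero (f ∘ suc) λ i → f≡0 (suc i) λ ())) (ℚ.+-identityʳ (f zero))
sum-single f (suc j) f≡0 = trans (cong₂ _+_ (f≡0 zero λ ()) (sum-single (f ∘ suc) j λ i i≢j → f≡0 (suc i) (i≢j ∘ Fin.suc-injective)))
  (ℚ.+-identityˡ (f (suc j)))

sum-linear : ∀ {k} (f g : Fin k → ℚ) a b → sum (λ i → a * f i + b * g i) ≡ a * sum f + b * sum g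
sum-linear f g a b = trans (∑-distrib-+ (λ i → a * f i) (λ i → b * g i))
  (sym (cong₂ _+_ (*-distribˡ-sum a f) (*-distribˡ-sum b g)))

linear-neg : {f : F N → F M} → Linear f → ∀ x → f (λ σ → - x σ) ≗ λ τ → - f x τ
linear-neg {f = f} lf x τ = trans
  (resp lf (λ σ → solve 1 (λ p → :- p := con (- 1ℚ) :* p) refl (x σ)) τ)
  (trans (linear-* lf (- 1ℚ) x τ) (solve 1 (λ p → con (- 1ℚ) :* p := :- p) refl (f x τ)))

linear-sum : {f : F N → F M} → Linear f → ∀ {k} (c : Fin k → ℚ) (x : Fin k → F N) →
             f (λ σ → sum λ i → c i * x i σ) ≗ λ τ → sum λ i → c i * f (x i) τ
linear-sum lf {zero}  c x τ = linear-0 lf τ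
linear-sum {f = f} lf {suc k} c x τ = trans
  (linear-+ lf (λ σ → c zero * x zero σ) (λ σ → sum λ i → c (suc i) * x (suc i) σ) τ)
  (cong₂ _+_ (linear-* lf (c zero) (x zero) τ) (linear-sum lf (c ∘ suc) (x ∘ suc) τ))

-- Adding a vertex to a simplex

insert : Fin N → Subset N → Subset N
insert v τ = τ [ v ]≔ inside

insert-⊥ : ∀ (v : Fin N) → insert v ⊥ ≡ ⁅ v ⁆
insert-⊥ zero    = refl
insert-⊥ (suc v) = cong (outside ∷_) (insert-⊥ v)

∈-insert : ∀ (v : Fin N) τ → v ∈ insert v τ
∈-insert v τ = []≔-updates τ v

⊆-insert : ∀ (v : Fin N) τ → τ ⊆ insert v τ
⊆-insert zero    (_ ∷ τ) here        = here
⊆-insert zero    (_ ∷ τ) (there u∈τ) = there u∈τ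
⊆-insert (suc v) (_ ∷ τ) here        = here
⊆-insert (suc v) (_ ∷ τ) (there u∈τ) = there (⊆-insert v τ u∈τ)

∈-insert⁻ : ∀ (v : Fin N) τ {u} → u ∈ insert v τ → u ≡ v ⊎ u ∈ τ
∈-insert⁻ zero    (_ ∷ τ) here        = inj₁ refl
∈-insert⁻ zero    (_ ∷ τ) (there u∈τ) = inj₂ (there u∈τ)
∈-insert⁻ (suc v) (_ ∷ τ) here        = inj₂ here
∈-insert⁻ (suc v) (_ ∷ τ) (there u∈τ) with ∈-insert⁻ v τ u∈τ
... | inj₁ refl = inj₁ refl
... | inj₂ u∈   = inj₂ (there u∈)

∣insert∣ : ∀ (v : Fin N) τ → v ∉ τ → ∣ insert v τ ∣ ≡ suc ∣ τ ∣
∣insert∣ zero    (inside  ∷ τ) v∉τ = contradiction here v∉τ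
∣insert∣ zero    (outside ∷ τ) v∉τ = refl
∣insert∣ (suc v) (inside  ∷ τ) v∉τ = cong suc (∣insert∣ v τ (v∉τ ∘ there))
∣insert∣ (suc v) (outside ∷ τ) v∉τ = ∣insert∣ v τ (v∉τ ∘ there)

-- The simplicial boundary

∂-supp : ∀ {P Q : Pred (Subset N) 0ℓ} {x} →
         (∀ τ v → v ∉ τ → P (insert v τ) → Q τ) → Supp P x → Supp Q (∂ x)
∂-supp {P = P} {x = x} P⇒Q sx τ ¬Q = sum-zero _ term
  where
  term : ∀ v → (if does (v ∈? τ) then 0ℚ else sign v τ * x (insert v τ)) ≡ 0ℚ
  term v with v ∈? τ
  ... | yes _   = refl
  ... | no  v∉τ = trans (cong (sign v τ *_) (sx _ (¬Q ∘ P⇒Q τ v v∉τ))) (ℚ.*-zeroʳ (sign v τ))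

∂-local : ∀ (x y : F N) τ → (∀ v → v ∉ τ → x (insert v τ) ≡ y (insert v τ)) → ∂ x τ ≡ ∂ y τ
∂-local x y τ eq = sum-cong-≗ term
  where
  term : ∀ v → (if does (v ∈? τ) then 0ℚ else sign v τ * x (insert v τ)) ≡
               (if does (v ∈? τ) then 0ℚ else sign v τ * y (insert v τ))
  term v with v ∈? τ
  ... | yes _   = refl
  ... | no  v∉τ = cong (sign v τ *_) (eq v v∉τ)

-- With `v` the first vertex, write `x = xₒ + v ∧ xᵢ`. Then `∂ x = (xᵢ + ∂ xₒ) - v ∧ ∂ xᵢ`; this
-- formula and the next are its two components and drive the inductions on `N`.
∂-outside : ∀ (x : F (suc N)) τ → ∂ x (outside ∷ τ) ≡ x (inside ∷ τ) + ∂ (x ∘ (outside ∷_)) τ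
∂-outside x τ = cong (_+ ∂ (x ∘ (outside ∷_)) τ) (ℚ.*-identityˡ (x (inside ∷ τ)))

∂-inside : ∀ (x : F (suc N)) τ → ∂ x (inside ∷ τ) ≡ - ∂ (x ∘ (inside ∷_)) τ
∂-inside x τ = begin
  0ℚ + sum (λ v → term- v)  ≡⟨ ℚ.+-identityˡ _ ⟩
  sum (λ v → term- v)       ≡⟨ sum-cong-≗ eq ⟩
  sum (λ v → - 1ℚ * term v) ≡⟨ *-distribˡ-sum (- 1ℚ) term ⟨
  - 1ℚ * sum term           ≡⟨ solve 1 (λ p → con (- 1ℚ) :* p := :- p) refl (sum term) ⟩
  - sum term                ∎
  where
  term term- : Fin _ → ℚ
  term  v = if does (v ∈? τ) then 0ℚ else sign v τ * x (inside ∷ insert v τ)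
  term- v = if does (v ∈? τ) then 0ℚ else (- sign v τ) * x (inside ∷ insert v τ)
  eq : ∀ v → term- v ≡ - 1ℚ * term v
  eq v with does (v ∈? τ)
  ... | true  = refl
  ... | false = solve 2 (λ p q → (:- p) :* q := con (- 1ℚ) :* (p :* q)) refl (sign v τ) (x (inside ∷ insert v τ))

∂∂≗0 : ∀ (x : F N) → ∂ (∂ x) ≗ 𝟎
∂∂≗0 {zero}  x []            = refl
∂∂≗0 {suc N} x (outside ∷ τ) = begin
  ∂ (∂ x) (outside ∷ τ)                            ≡⟨ ∂-outside (∂ x) τ ⟩
  ∂ x (inside ∷ τ) + ∂ (∂ x ∘ (outside ∷_)) τ      ≡⟨ cong₂ _+_ (∂-inside x τ) (trans (resp ∂-linear (∂-outside x) τ) (linear-+ ∂-linear xᵢ (∂ xₒ) τ)) ⟩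
  - ∂ xᵢ τ + (∂ xᵢ τ + ∂ (∂ xₒ) τ)                 ≡⟨ cong (λ q → - ∂ xᵢ τ + (∂ xᵢ τ + q)) (∂∂≗0 xₒ τ) ⟩
  - ∂ xᵢ τ + (∂ xᵢ τ + 0ℚ)                         ≡⟨ solve 1 (λ p → (:- p) :+ (p :+ con 0ℚ) := con 0ℚ) refl (∂ xᵢ τ) ⟩
  0ℚ                                               ∎
  where
  xᵢ = x ∘ (inside ∷_)
  xₒ = x ∘ (outside ∷_)
∂∂≗0 {suc N} x (inside ∷ τ) = begin
  ∂ (∂ x) (inside ∷ τ)            ≡⟨ ∂-inside (∂ x) τ ⟩
  - ∂ (∂ x ∘ (inside ∷_)) τ       ≡⟨ cong -_ (resp ∂-linear (∂-inside x) τ) ⟩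
  - ∂ (λ σ → - ∂ xᵢ σ) τ          ≡⟨ cong -_ (linear-neg ∂-linear (∂ xᵢ) τ) ⟩
  - (- ∂ (∂ xᵢ) τ)                ≡⟨ cong (λ q → - (- q)) (∂∂≗0 xᵢ τ) ⟩
  0ℚ                              ∎
  where
  xᵢ = x ∘ (inside ∷_)

-- Exterior multiplication by a vertex

wedge : Fin N → F N → F N
wedge zero    x (outside ∷ τ) = 0ℚ
wedge zero    x (inside  ∷ τ) = x (outside ∷ τ)
wedge (suc v) x (outside ∷ τ) = wedge v (x ∘ (outside ∷_)) τ
wedge (suc v) x (inside  ∷ τ) = - wedge v (x ∘ (inside ∷_)) τ

wedge-linear : ∀ (v : Fin N) → Linear (wedge v)
resp (wedge-linear zero)    x≗y (outside ∷ τ) = refl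
resp (wedge-linear zero)    x≗y (inside  ∷ τ) = x≗y (outside ∷ τ)
resp (wedge-linear (suc v)) x≗y (outside ∷ τ) = resp (wedge-linear v) (x≗y ∘ (outside ∷_)) τ
resp (wedge-linear (suc v)) x≗y (inside  ∷ τ) = cong -_ (resp (wedge-linear v) (x≗y ∘ (inside ∷_)) τ)
comb (wedge-linear zero)    a b x y (outside ∷ τ) = solve 2 (λ c d → con 0ℚ := c :* con 0ℚ :+ d :* con 0ℚ) refl a b
comb (wedge-linear zero)    a b x y (inside  ∷ τ) = refl
comb (wedge-linear (suc v)) a b x y (outside ∷ τ) = comb (wedge-linear v) a b _ _ τ
comb (wedge-linear (suc v)) a b x y (inside  ∷ τ) = trans
  (cong -_ (comb (wedge-linear v) a b (x ∘ (inside ∷_)) (y ∘ (inside ∷_)) τ))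
  (solve 4 (λ a b p q → :- (a :* p :+ b :* q) := a :* (:- p) :+ b :* (:- q)) refl a b
    (wedge v (x ∘ (inside ∷_)) τ) (wedge v (y ∘ (inside ∷_)) τ))

-- Phrased through `insert`, so that supports are tracked without deleting `v` from `σ`.
wedge-zero : ∀ (v : Fin N) x σ → (∀ τ → v ∉ τ → insert v τ ≡ σ → x τ ≡ 0ℚ) → wedge v x σ ≡ 0ℚ
wedge-zero zero    x (outside ∷ σ) h = refl
wedge-zero zero    x (inside  ∷ σ) h = h (outside ∷ σ) (λ ()) refl
wedge-zero (suc v) x (outside ∷ σ) h = wedge-zero v _ σ λ τ v∉τ eq →
  h (outside ∷ τ) (v∉τ ∘ λ { (there p) → p }) (cong (outside ∷_) eq)
wedge-zero (suc v) x (inside  ∷ σ) h = cong -_ (wedge-zero v _ σ λ τ v∉τ eq →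
  h (inside ∷ τ) (v∉τ ∘ λ { (there p) → p }) (cong (inside ∷_) eq))

wedge-supp : ∀ {P Q : Pred (Subset N) 0ℓ} {x} v → (∀ τ → v ∉ τ → P τ → Q (insert v τ)) →
             Supp P x → Supp Q (wedge v x)
wedge-supp {x = x} v P⇒Q sx σ ¬Q = wedge-zero v x σ λ { τ v∉τ refl → sx τ (¬Q ∘ P⇒Q τ v∉τ) }

-- The Leibniz rule: coning with apex `v` is a contracting homotopy of the full simplex on `Fin N`.
∂-wedge : ∀ (v : Fin N) x → ∂ (wedge v x) ≗ x ⊖ wedge v (∂ x)
∂-wedge zero x (outside ∷ τ) = begin
  ∂ (wedge zero x) (outside ∷ τ)        ≡⟨ ∂-outside (wedge zero x) τ ⟩
  x (outside ∷ τ) + ∂ 𝟎 τ               ≡⟨ cong (x (outside ∷ τ) +_) (linear-0 ∂-linear τ) ⟩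
  x (outside ∷ τ) + 0ℚ                  ∎
∂-wedge zero x (inside ∷ τ) = begin
  ∂ (wedge zero x) (inside ∷ τ)                       ≡⟨ ∂-inside (wedge zero x) τ ⟩
  - ∂ (x ∘ (outside ∷_)) τ                            ≡⟨ solve 2 (λ p q → :- p := q :- (q :+ p)) refl (∂ (x ∘ (outside ∷_)) τ) (x (inside ∷ τ)) ⟩
  x (inside ∷ τ) - (x (inside ∷ τ) + ∂ (x ∘ (outside ∷_)) τ) ≡⟨ cong (λ q → x (inside ∷ τ) - q) (∂-outside x τ) ⟨
  x (inside ∷ τ) - ∂ x (outside ∷ τ)                  ∎
∂-wedge (suc v) x (outside ∷ τ) = begin
  ∂ (wedge (suc v) x) (outside ∷ τ)          ≡⟨ ∂-outside (wedge (suc v) x) τ ⟩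
  - wedge v xᵢ τ + ∂ (wedge v xₒ) τ           ≡⟨ cong (- wedge v xᵢ τ +_) (∂-wedge v xₒ τ) ⟩
  - wedge v xᵢ τ + (xₒ τ - wedge v (∂ xₒ) τ)  ≡⟨ solve 3 (λ p q r → (:- p) :+ (q :- r) := q :- (p :+ r)) refl (wedge v xᵢ τ) (xₒ τ) (wedge v (∂ xₒ) τ) ⟩
  xₒ τ - (wedge v xᵢ τ + wedge v (∂ xₒ) τ)    ≡⟨ cong (λ q → xₒ τ - q) (trans (resp (wedge-linear v) (∂-outside x) τ) (linear-+ (wedge-linear v) xᵢ (∂ xₒ) τ)) ⟨
  xₒ τ - wedge v (∂ x ∘ (outside ∷_)) τ       ∎
  where
  xᵢ = x ∘ (inside ∷_)
  xₒ = x ∘ (outside ∷_)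
∂-wedge (suc v) x (inside ∷ τ) = begin
  ∂ (wedge (suc v) x) (inside ∷ τ)             ≡⟨ ∂-inside (wedge (suc v) x) τ ⟩
  - ∂ (λ σ → - wedge v xᵢ σ) τ                  ≡⟨ cong -_ (linear-neg ∂-linear (wedge v xᵢ) τ) ⟩
  - (- ∂ (wedge v xᵢ) τ)                        ≡⟨ cong (λ q → - (- q)) (∂-wedge v xᵢ τ) ⟩
  - (- (xᵢ τ - wedge v (∂ xᵢ) τ))               ≡⟨ solve 2 (λ p q → :- (:- (p :- q)) := p :- (:- (:- q))) refl (xᵢ τ) (wedge v (∂ xᵢ) τ) ⟩
  xᵢ τ - - (- wedge v (∂ xᵢ) τ)                 ≡⟨ cong (λ q → xᵢ τ - - q) (trans (resp (wedge-linear v) (∂-inside x) τ) (linear-neg (wedge-linear v) (∂ xᵢ) τ)) ⟨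
  xᵢ τ - - wedge v (∂ x ∘ (inside ∷_)) τ        ∎
  where
  xᵢ = x ∘ (inside ∷_)

-- This takes place in the full simplex; that the cone stays inside a given complex is checked
-- separately through supports.
wedge-fills : ∀ v {x : F N} → ∂ x ≗ 𝟎 → ∂ (wedge v x) ≗ x
wedge-fills v {x} ∂x≗0 τ = trans (∂-wedge v x τ)
  (trans (cong (λ q → x τ - q) (trans (resp (wedge-linear v) ∂x≗0 τ) (linear-0 (wedge-linear v) τ)))
    (solve 1 (λ p → p :- con 0ℚ := p) refl (x τ)))

-- Chains relative to a set of colors

-- A coefficient of the boundary at `τ` reads only simplices `insert v τ`, and for `τ` in `Q` none
-- of these is erased by `keep P?`.
keep-∂-keep : ∀ {P Q : Pred (Subset N) 0ℓ} (P? : Decidable P) (Q? : Decidable Q) →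
              (∀ τ v → Q τ → P (insert v τ)) → ∀ x → keep Q? (∂ (keep P? x)) ≗ keep Q? (∂ x)
keep-∂-keep P? Q? Q⇒P x τ with Q? τ
... | yes q = ∂-local (keep P? x) x τ λ v _ → keep-yes P? x (insert v τ) (Q⇒P τ v q)
... | no  _ = refl

-- Removing an element, unions, and lists of colors.

∣p-x∣ : ∀ {p : Subset N} {x} → x ∈ p → ∣ p ∣ ≡ suc ∣ p ∖ x ∣
∣p-x∣ {p = inside ∷ p}  here        = cong (suc ∘ ∣_∣) (sym (p─⊥≡p p))
∣p-x∣ {p = inside ∷ p}  (there x∈p) = cong suc (∣p-x∣ x∈p)
∣p-x∣ {p = outside ∷ p} (there x∈p) = ∣p-x∣ x∈p

x∉p-x : ∀ (p : Subset N) x → x ∉ p ∖ x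
x∉p-x (_ ∷ p) (suc x) (there x∈) = x∉p-x p x x∈

p-x⊆p : ∀ (p : Subset N) x → p ∖ x ⊆ p
p-x⊆p p x = p─q⊆p p ⁅ x ⁆

∈-p-x⁻ : ∀ (p : Subset N) {x y} → y ∈ p ∖ x → y ≢ x
∈-p-x⁻ p y∈ refl = x∉p-x p _ y∈

-x-mono : ∀ {p q : Subset N} x → p ⊆ q → p ∖ x ⊆ q ∖ x
-x-mono {p = p} x p⊆q y∈ = x∈p∧x≢y⇒x∈p-y (p⊆q (p-x⊆p p x y∈)) (∈-p-x⁻ p y∈)

∈-⋃⁺ : ∀ {A : Set} (f : A → Subset N) {xs a v} → a ∈ˡ xs → v ∈ f a → v ∈ ⋃ (map f xs)
∈-⋃⁺ f {x ∷ xs} (here refl) v∈ = p⊆p∪q (⋃ (map f xs)) v∈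
∈-⋃⁺ f {x ∷ xs} (there a∈)  v∈ = q⊆p∪q (f x) (⋃ (map f xs)) (∈-⋃⁺ f a∈ v∈)

∈-⋃⁻ : ∀ {A : Set} (f : A → Subset N) xs {v} → v ∈ ⋃ (map f xs) → ∃ λ a → a ∈ˡ xs × v ∈ f a
∈-⋃⁻ f []       v∈ = contradiction v∈ ∉⊥
∈-⋃⁻ f (x ∷ xs) v∈ with x∈p∪q⁻ (f x) (⋃ (map f xs)) v∈
... | inj₁ v∈fx = x , here refl , v∈fx
... | inj₂ v∈⋃  with ∈-⋃⁻ f xs v∈⋃
...   | a , a∈ , v∈fa = a , there a∈ , v∈fa

-- Each color is removed from `I` once it is listed, so the list has no repetitions.
data Enumerates {n} (I : Subset n) : List (Fin n) → Set where
  []  : Empty I → Enumerates I []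
  _∷_ : ∀ {j J} → j ∈ I → Enumerates (I ∖ j) J → Enumerates I (j ∷ J)

-- A list of distinct colors of `I` that leaves out at least one; the nonempty remainder is where
-- the hypothesis on the complexes gets applied.
data Misses {n} (I : Subset n) : List (Fin n) → Set where
  []  : Nonempty I → Misses I []
  _∷_ : ∀ {j J} → j ∈ I → Misses (I ∖ j) J → Misses I (j ∷ J)

module _ {n : ℕ} where

  enumerates-length : ∀ {I : Subset n} {J} → Enumerates I J → ∣ I ∣ ≡ length J
  enumerates-length ([] empty)   = trans (cong ∣_∣ (Empty-unique empty)) (∣⊥∣≡0 n)
  enumerates-length (j∈I ∷ en) = trans (∣p-x∣ j∈I) (cong suc (enumerates-length en))

  enumerates-⊆ : ∀ {I : Subset n} {J} → Enumerates I J → All (_∈ I) J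
  enumerates-⊆         ([] _)         = []
  enumerates-⊆ {I = I} (_∷_ {j} j∈I en) = j∈I ∷ All.map (p-x⊆p I j) (enumerates-⊆ en)

  enumerates-⊇ : ∀ {I : Subset n} {J} → Enumerates I J → ∀ {i} → i ∈ I → i ∈ˡ J
  enumerates-⊇ ([] empty)         i∈I = contradiction (_ , i∈I) empty
  enumerates-⊇ (_∷_ {j} j∈I en) {i} i∈I with i Fin.≟ j
  ... | yes refl = here refl
  ... | no  i≢j  = there (enumerates-⊇ en (x∈p∧x≢y⇒x∈p-y i∈I i≢j))

  enumeration : ∀ (I : Subset n) → ∃ (Enumerates I)
  enumeration I = go ∣ I ∣ I refl
    where
    go : ∀ k I → ∣ I ∣ ≡ k → ∃ (Enumerates I)
    go k I ∣I∣≡k with nonempty? I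
    ... | no empty = [] , [] empty
    go zero    I ∣I∣≡k | yes (j , j∈I) = contradiction (trans (sym ∣I∣≡k) (∣p-x∣ j∈I)) λ ()
    go (suc k) I ∣I∣≡k | yes (j , j∈I) with go k (I ∖ j) (ℕ.suc-injective (trans (sym (∣p-x∣ j∈I)) ∣I∣≡k))
    ... | J , en = j ∷ J , j∈I ∷ en

  misses-mono : ∀ {I I′ : Subset n} {J} → I ⊆ I′ → Misses I J → Misses I′ J
  misses-mono I⊆I′ ([] (i , i∈I)) = [] (i , I⊆I′ i∈I)
  misses-mono I⊆I′ (j∈I ∷ ms)     = I⊆I′ j∈I ∷ misses-mono (-x-mono _ I⊆I′) ms

  -- Used with `I = I′ ∖ x`: listing all the other colors leaves out `x`.
  enumerates⇒misses : ∀ {I I′ : Subset n} {J x} → I ⊆ I′ → x ∈ I′ → x ∉ I → Enumerates I J → Misses I′ J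
  enumerates⇒misses I⊆I′ x∈ x∉ ([] _) = [] (_ , x∈)
  enumerates⇒misses {I} {x = x} I⊆I′ x∈ x∉ (_∷_ {j} j∈I en) = I⊆I′ j∈I ∷
    enumerates⇒misses (-x-mono j I⊆I′) (x∈p∧x≢y⇒x∈p-y x∈ λ { refl → x∉ j∈I }) (x∉ ∘ p-x⊆p I j) en

-- Rainbow simplices and the relative boundary.

module Relative {N n : ℕ} {C : Complex N} (V : Partition C n) where

  Meets : Fin n → Pred (Subset N) 0ℓ
  Meets j σ = Nonempty (σ ∩ class V j)

  meets? : ∀ j → Decidable (Meets j)
  meets? j σ = nonempty? (σ ∩ class V j)

  meets-mono : ∀ {j σ τ} → σ ⊆ τ → Meets j σ → Meets j τ
  meets-mono {j} {σ} {τ} σ⊆τ (v , v∈) with x∈p∩q⁻ σ (class V j) v∈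
  ... | v∈σ , v∈V = v , x∈p∩q⁺ (σ⊆τ v∈σ , v∈V)

  Rainbow : List (Fin n) → Pred (Subset N) 0ℓ
  Rainbow J σ = All (λ j → Meets j σ) J

  rainbow? : ∀ J → Decidable (Rainbow J)
  rainbow? J σ = All.all? (λ j → meets? j σ) J

  rainbow-mono : ∀ {J σ τ} → σ ⊆ τ → Rainbow J σ → Rainbow J τ
  rainbow-mono σ⊆τ = All.map (meets-mono σ⊆τ)

  class-∈ : ∀ {I i v} → i ∈ I → v ∈ class V i → v ∈ ⋃[ I ] V
  class-∈ {I} {i} i∈I v∈ = ∈-⋃⁺ (class V) (∈-filter⁺ (_∈? I) (∈-allFin i) i∈I) v∈

  ∈-class : ∀ {I v} → v ∈ ⋃[ I ] V → ∃ λ i → i ∈ I × v ∈ class V i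
  ∈-class {I} v∈ with ∈-⋃⁻ (class V) (filter (_∈? I) (allFin n)) v∈
  ... | i , i∈ , v∈i = i , proj₂ (∈-filter⁻ (_∈? I) {xs = allFin n} i∈) , v∈i

  ⋃-mono : ∀ {I I′} → I ⊆ I′ → ⋃[ I ] V ⊆ ⋃[ I′ ] V
  ⋃-mono I⊆I′ v∈ with ∈-class v∈
  ... | i , i∈I , v∈i = class-∈ (I⊆I′ i∈I) v∈i

  ⋃-avoid : ∀ {I j σ} → σ ⊆ ⋃[ I ] V → ¬ Meets j σ → σ ⊆ ⋃[ I ∖ j ] V
  ⋃-avoid {j = j} σ⊆ ¬m {v} v∈σ with ∈-class (σ⊆ v∈σ)
  ... | i , i∈I , v∈i = class-∈ (x∈p∧x≢y⇒x∈p-y i∈I λ { refl → ¬m (v , x∈p∩q⁺ (v∈σ , v∈i)) }) v∈i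

  ⋃-avoids : ∀ {I j σ} → σ ⊆ ⋃[ I ∖ j ] V → ¬ Meets j σ
  ⋃-avoids {I} {j} {σ} σ⊆ (v , v∈) with x∈p∩q⁻ σ (class V j) v∈
  ... | v∈σ , v∈j with ∈-class (σ⊆ v∈σ)
  ...   | i , i∈ , v∈i = ∈-p-x⁻ I i∈ (disjoint V v∈i v∈j)

  -- Classes are disjoint, so removing the vertex chosen for `j` leaves the remaining colors of the
  -- list represented.
  rainbow-length : ∀ {I J σ} → Enumerates I J → Rainbow J σ → length J ℕ.≤ ∣ σ ∣
  rainbow-length ([] _) [] = z≤n
  rainbow-length {I} {σ = σ} (_∷_ {j} {J} j∈I en) ((v , v∈) ∷ r) with x∈p∩q⁻ σ (class V j) v∈
  ... | v∈σ , v∈j = ℕ.≤-trans (s≤s (rainbow-length en (All.zipWith avoid (enumerates-⊆ en , r)))) (x∈p⇒∣p-x∣<∣p∣ v∈σ)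
    where
    avoid : ∀ {i} → i ∈ I ∖ j × Meets i σ → Meets i (σ ∖ v)
    avoid {i} (i∈ , u , u∈) with x∈p∩q⁻ σ (class V i) u∈
    ... | u∈σ , u∈i = u , x∈p∩q⁺ (x∈p∧x≢y⇒x∈p-y u∈σ (λ { refl → ∈-p-x⁻ I i∈ (disjoint V u∈i v∈j) }) , u∈i)

  -- The boundary of the quotient by the simplices that miss a color of `J`; quotient chains are
  -- represented by chains supported on rainbow simplices.
  ∂[_] : List (Fin n) → F N → F N
  ∂[ J ] x = keep (rainbow? J) (∂ x)

  ∂[]-linear : ∀ J → Linear ∂[ J ]
  ∂[]-linear J = ∘-linear (keep-linear (rainbow? J)) ∂-linear

  ∂[]∂[]≗0 : ∀ J x → ∂[ J ] (∂[ J ] x) ≗ 𝟎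
  ∂[]∂[]≗0 J x τ = begin
    ∂[ J ] (∂[ J ] x) τ          ≡⟨ keep-∂-keep (rainbow? J) (rainbow? J) (λ τ v → rainbow-mono (⊆-insert v τ)) (∂ x) τ ⟩
    keep (rainbow? J) (∂ (∂ x)) τ ≡⟨ resp (keep-linear (rainbow? J)) (∂∂≗0 x) τ ⟩
    keep (rainbow? J) 𝟎 τ        ≡⟨ linear-0 (keep-linear (rainbow? J)) τ ⟩
    0ℚ                           ∎

  -- The composite of the connecting homomorphisms of the short exact sequences
  -- 0 → R(I ∖ j, J) → R(I, J) → R(I, j ∷ J) → 0, where R(I, J) consists of the
  -- simplices with colors in I that meet every color of J.
  residue : List (Fin n) → F N → F N
  residue []      x = x
  residue (j ∷ J) x = residue J (∂[ J ] x)

  residue-linear : ∀ J → Linear (residue J)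
  residue-linear []      = id-linear
  residue-linear (j ∷ J) = ∘-linear (residue-linear J) (∂[]-linear J)

  -- When `J` exhausts the colors, the connecting homomorphisms end in the complex on no colors,
  -- whose only simplex is `⊥`.
  ε : List (Fin n) → F N → ℚ
  ε J x = residue J x ⊥

  RelSimplex : Complex N → List (Fin n) → ℕ → Pred (Subset N) 0ℓ
  RelSimplex K J d σ = IsSimplex K d σ × Rainbow J σ

  RelChain : Complex N → List (Fin n) → ℕ → Pred (F N) 0ℓ
  RelChain K J d = Supp (RelSimplex K J d)

  RelExact : Complex N → List (Fin n) → ℕ → Set
  RelExact K J d = ∀ z → RelChain K J d z → ∂[ J ] z ≗ 𝟎 →
                   ∃ λ w → RelChain K J (suc d) w × ∂[ J ] w ≗ z

  ∂[]-chain : ∀ {K J d x} → RelChain K [] (suc d) x → RelChain K J d (∂[ J ] x)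
  ∂[]-chain {K} {J} {d} cx = keep-supp-∩ (rainbow? J) (λ r s → s , r) (∂-supp face cx)
    where
    face : ∀ τ v → v ∉ τ → RelSimplex K [] (suc d) (insert v τ) → IsSimplex K d τ
    face τ v v∉τ ((Kσ , ∣σ∣≡) , _) =
      ⊆-closed K (⊆-insert v τ) Kσ , ℕ.suc-injective (trans (sym (∣insert∣ v τ v∉τ)) ∣σ∣≡)

  forget : ∀ {K J d x} → RelChain K J d x → RelChain K [] d x
  forget = supp-mono λ { (s , _) → s , [] }

  forget-∷ : ∀ {K j J d x} → RelChain K (j ∷ J) d x → RelChain K J d x
  forget-∷ = supp-mono λ { (s , _ ∷ r) → s , r }

  -- A facet of a simplex with `length J` vertices has too few vertices to meet every color of `J`.
  ∂[]-low : ∀ {K I J x} → Enumerates I J → RelChain K [] (length J) x → ∂[ J ] x ≗ 𝟎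
  ∂[]-low {K} {I} {J} {x} en cx τ with rainbow? J τ
  ... | no  _ = refl
  ... | yes r = trans (∂-local x 𝟎 τ λ v v∉τ → cx (insert v τ) λ { ((_ , ∣σ∣≡) , _) →
                        ℕ.<⇒≱ (ℕ.≤-reflexive (trans (sym (∣insert∣ v τ v∉τ)) ∣σ∣≡)) (rainbow-length en r) })
                      (linear-0 ∂-linear τ)

  ∂[]-bottom : ∀ {K J x} → RelChain K [] 0 x → ∂[ J ] x ≗ 𝟎
  ∂[]-bottom {K} {J} {x} cx τ = trans (resp (keep-linear (rainbow? J)) ∂x≗0 τ) (linear-0 (keep-linear (rainbow? J)) τ)
    where
    ∂x≗0 : ∂ x ≗ 𝟎
    ∂x≗0 τ = trans (∂-local x 𝟎 τ λ v v∉τ → cx (insert v τ) λ { ((_ , ∣σ∣≡) , _) →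
      contradiction (trans (sym (∣insert∣ v τ v∉τ)) ∣σ∣≡) λ () }) (linear-0 ∂-linear τ)

  -- `residue J` lowers the number of vertices by `length J`, and `ε` reads the coefficient of the
  -- empty simplex.
  ε-degree : ∀ J {x} → Supp (λ σ → ∣ σ ∣ ≢ length J) x → ε J x ≡ 0ℚ
  ε-degree []      sx = sx ⊥ λ ∣⊥∣≢0 → ∣⊥∣≢0 (∣⊥∣≡0 N)
  ε-degree (j ∷ J) sx = ε-degree J (keep-supp-∩ (rainbow? J) (λ _ → id)
    (∂-supp (λ τ v v∉τ ∣σ∣≢ ∣τ∣≡ → ∣σ∣≢ (trans (∣insert∣ v τ v∉τ) (cong suc ∣τ∣≡))) sx))

  -- The difference `y` of `∂[ J ] x` and `∂[ j ∷ J ] x` consists of simplices avoiding `j`. As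
  -- `∂[ J ]` squares to zero, only the term `∂[ J ] y` remains, and induction over the colors
  -- `I ∖ j` kills it.
  ε-∂[] : ∀ {I J x} → Enumerates I J → Supp (_⊆ ⋃[ I ] V) x → ε J (∂[ J ] x) ≡ 0ℚ
  ε-∂[] {I} {[]} {x} ([] empty) sx =
    trans (∂-local x 𝟎 ⊥ λ v _ → sx (insert v ⊥) λ ⊆X →
             let i , i∈I , _ = ∈-class (⊆X (∈-insert v ⊥)) in empty (i , i∈I))
          (linear-0 (∂-linear {N}) ⊥)
  ε-∂[] {I} {j ∷ J} {x} (j∈I ∷ en) sx = begin
    ε J (∂[ J ] (∂[ j ∷ J ] x))                    ≡⟨ resp (residue-linear J) split-∂ ⊥ ⟩
    ε J (∂[ J ] (∂[ J ] x) ⊖ ∂[ J ] y)             ≡⟨ linear-∸ (residue-linear J) (∂[ J ] (∂[ J ] x)) (∂[ J ] y) ⊥ ⟩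
    ε J (∂[ J ] (∂[ J ] x)) - ε J (∂[ J ] y)       ≡⟨ cong₂ _-_ (trans (resp (residue-linear J) (∂[]∂[]≗0 J x) ⊥) (linear-0 (residue-linear J) ⊥)) (ε-∂[] en sy) ⟩
    0ℚ                                             ∎
    where
    y : F N
    y = ∂[ J ] x ⊖ ∂[ j ∷ J ] x
    split-∂ : ∂[ J ] (∂[ j ∷ J ] x) ≗ ∂[ J ] (∂[ J ] x) ⊖ ∂[ J ] y
    split-∂ τ = trans (resp (∂[]-linear J) {y = ∂[ J ] x ⊖ y}
        (λ σ → solve 2 (λ p q → p := q :- (q :- p)) refl (∂[ j ∷ J ] x σ) (∂[ J ] x σ)) τ)
      (linear-∸ (∂[]-linear J) (∂[ J ] x) y τ)
    s∂x : Supp (_⊆ ⋃[ I ] V) (∂ x)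
    s∂x = ∂-supp (λ τ v _ → ⊆-trans (⊆-insert v τ)) sx
    sy : Supp (_⊆ ⋃[ I ∖ j ] V) y
    sy σ ⊈ with rainbow? J σ | meets? j σ
    ... | no _  | yes _ = refl
    ... | no _  | no _  = refl
    ... | yes _ | yes _ = ℚ.+-inverseʳ (∂ x σ)
    ... | yes _ | no ¬m = cong (_- 0ℚ) (s∂x σ λ σ⊆ → ⊈ (⋃-avoid σ⊆ ¬m))

  -- Exactness of the relative complexes.

  module Acyclic (K : Complex N) where

    K[_] : Subset n → Complex N
    K[ I ] = K [[ ⋃[ I ] V ]]

    enlarge : ∀ {I j J d x} → RelChain K[ I ∖ j ] J d x → RelChain K[ I ] J d x
    enlarge {I} {j} = supp-mono λ { (((Kσ , σ⊆) , ∣σ∣≡) , r) → ((Kσ , ⊆-trans σ⊆ (⋃-mono (p-x⊆p I j))) , ∣σ∣≡) , r }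

    -- The connecting homomorphism on chains: a cycle modulo the simplices avoiding `j` has its
    -- boundary among those simplices.
    connecting : ∀ {I j J d z} → RelChain K[ I ] (j ∷ J) (suc d) z → ∂[ j ∷ J ] z ≗ 𝟎 →
                 RelChain K[ I ∖ j ] J d (∂[ J ] z)
    connecting {I} {j} {J} {d} {z} cz ∂z≗0 = supp-∩ shrink (∂[]-chain {K[ I ]} {J} (forget {K[ I ]} {j ∷ J} cz)) avoids
      where
      avoids : Supp (λ σ → ¬ Meets j σ) (∂[ J ] z)
      avoids σ ¬¬m with rainbow? J σ
      ... | no _  = refl
      ... | yes r = trans (sym (keep-yes (rainbow? (j ∷ J)) (∂ z) σ (decidable-stable (meets? j σ) ¬¬m ∷ r))) (∂z≗0 σ)
      shrink : ∀ {σ} → RelSimplex K[ I ] J d σ → ¬ Meets j σ → RelSimplex K[ I ∖ j ] J d σ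
      shrink (((Kσ , σ⊆) , ∣σ∣≡) , r) ¬m = ((Kσ , ⋃-avoid σ⊆ ¬m) , ∣σ∣≡) , r

    -- The diagram chase of the long exact sequence: `z ⊖ w` is a cycle for `∂[ J ]`, hence a
    -- boundary. Discarding the simplices that avoid `j` from its filling removes `w` from the
    -- boundary and leaves `z`.
    lift : ∀ {I j J d z w} → RelExact K[ I ] J d → RelChain K[ I ] (j ∷ J) d z → RelChain K[ I ∖ j ] J d w →
           ∂[ J ] w ≗ ∂[ J ] z → ∃ λ u → RelChain K[ I ] (j ∷ J) (suc d) u × ∂[ j ∷ J ] u ≗ z
    lift {I} {j} {J} {d} {z} {w} exact cz cw ∂w≗∂z =
      keep (meets? j) u , keep-supp-∩ (meets? j) (λ { m (s , r) → s , m ∷ r }) (proj₁ (proj₂ filling)) , λ τ → trans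
        (keep-∂-keep (meets? j) (rainbow? (j ∷ J)) (λ { τ v (m ∷ _) → meets-mono (⊆-insert v τ) m }) u τ)
        (keep-≗ (rainbow? (j ∷ J)) (supp-mono proj₂ cz) ∂u≡z τ)
      where
      cycle : ∂[ J ] (z ⊖ w) ≗ 𝟎
      cycle τ = trans (linear-∸ (∂[]-linear J) z w τ)
        (trans (cong (λ q → ∂[ J ] z τ - q) (∂w≗∂z τ)) (ℚ.+-inverseʳ (∂[ J ] z τ)))
      filling : ∃ λ u → RelChain K[ I ] J (suc d) u × ∂[ J ] u ≗ z ⊖ w
      filling = exact (z ⊖ w) (supp-⊖ (forget-∷ {K[ I ]} {j} {J} cz) (enlarge {I} {j} {J} cw)) cycle
      u : F N
      u = proj₁ filling
      ∂u≡z : ∀ τ → Rainbow (j ∷ J) τ → ∂ u τ ≡ z τ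
      ∂u≡z τ (m ∷ r) = begin
        ∂ u τ         ≡⟨ keep-yes (rainbow? J) (∂ u) τ r ⟨
        ∂[ J ] u τ    ≡⟨ proj₂ (proj₂ filling) τ ⟩
        z τ - w τ     ≡⟨ cong (λ q → z τ - q) (cw τ λ { (((_ , τ⊆) , _) , _) → ⋃-avoids τ⊆ m }) ⟩
        z τ - 0ℚ      ≡⟨ solve 1 (λ p → p :- con 0ℚ := p) refl (z τ) ⟩
        z τ           ∎

    module _ (m : ℕ) (exact : ∀ I → Nonempty I → ∀ d → d ℕ.< ∣ I ∣ ℕ.+ m → RelExact K[ I ] [] d) where

      -- Exactness at `(I , j ∷ J)` in degree `d` follows from exactness at `(I , J)` in degree `d`
      -- and at `(I ∖ j , J)` in degree `d - 1`; the bound drops by one together with the number of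
      -- colors.
      rel-exact : ∀ {I J} → Misses I J → ∀ d → d ℕ.< ∣ I ∣ ℕ.+ m → RelExact K[ I ] J d
      rel-exact ([] ne) d d< = exact _ ne d d<
      -- In degree zero `∂[ J ] z` already vanishes, so zero is a correction term.
      rel-exact {I} (_∷_ {j} {J} j∈I ms) zero d< z cz ∂z≗0 =
        lift {I} {j} {J} {w = 𝟎} (rel-exact (misses-mono (p-x⊆p I j) ms) zero d<) cz supp-𝟎
          λ τ → trans (linear-0 (∂[]-linear J) τ) (sym (∂[]-bottom {K[ I ]} {J} (forget {K[ I ]} {j ∷ J} cz) τ))
      rel-exact {I} (_∷_ {j} {J} j∈I ms) (suc d) d< z cz ∂z≗0 =
        lift {I} {j} {J} (rel-exact (misses-mono (p-x⊆p I j) ms) (suc d) d<) cz (proj₁ (proj₂ filling)) (proj₂ (proj₂ filling))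
        where
        filling : ∃ λ w → RelChain K[ I ∖ j ] J (suc d) w × ∂[ J ] w ≗ ∂[ J ] z
        filling = rel-exact ms d (ℕ.s≤s⁻¹ (subst (λ k → suc d ℕ.< k ℕ.+ m) (∣p-x∣ j∈I) d<))
          (∂[ J ] z) (connecting {I} {j} {J} cz ∂z≗0) (∂[]∂[]≗0 J z)

      -- Once `J` lists all of `I`, the induction ends at the complex on no colors, which has
      -- homology at the empty simplex; `ε` is exactly the coefficient there.
      ε-exact : ∀ {I J} → Enumerates I J → ∀ d → d ℕ.< m → ∀ z → RelChain K[ I ] J (length J ℕ.+ d) z →
                ∂[ J ] z ≗ 𝟎 → ε J z ≡ 0ℚ →
                ∃ λ w → RelChain K[ I ] J (suc (length J ℕ.+ d)) w × ∂[ J ] w ≗ z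
      ε-exact {I} ([] empty) d d<m z cz _ εz≡0 = 𝟎 , supp-𝟎 , λ τ →
        trans (linear-0 (∂[]-linear []) τ) (sym (z≗0 τ))
        where
        z≗0 : z ≗ 𝟎
        z≗0 τ with nonempty? τ
        ... | yes (v , v∈τ) = cz τ λ { (((_ , τ⊆) , _) , _) → let i , i∈I , _ = ∈-class (τ⊆ v∈τ) in empty (i , i∈I) }
        ... | no  ¬ne       = trans (cong z (Empty-unique ¬ne)) εz≡0
      ε-exact {I} (_∷_ {j} {J} j∈I en) d d<m z cz ∂z≗0 εz≡0 =
        lift {I} {j} {J} (rel-exact (enumerates⇒misses (p-x⊆p I j) j∈I (x∉p-x I j) en) (suc (length J ℕ.+ d)) d<)
          cz (proj₁ (proj₂ filling)) (proj₂ (proj₂ filling))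
        where
        filling : ∃ λ w → RelChain K[ I ∖ j ] J (suc (length J ℕ.+ d)) w × ∂[ J ] w ≗ ∂[ J ] z
        -- `ε (j ∷ J) z` unfolds to `ε J (∂[ J ] z)`, so the assumption on `z` passes on unchanged.
        filling = ε-exact en d d<m (∂[ J ] z) (connecting {I} {j} {J} cz ∂z≗0) (∂[]∂[]≗0 J z) εz≡0
        d< : suc (length J ℕ.+ d) ℕ.< ∣ I ∣ ℕ.+ m
        d< = subst (λ k → suc (length J ℕ.+ d) ℕ.< k ℕ.+ m) (sym (enumerates-length (j∈I ∷ en)))
               (s≤s (ℕ.+-monoʳ-< (length J) d<m))

      -- The connecting homomorphism is inverted: a chain with value 1 on the colors `I ∖ j` bounds
      -- some `u` in `(I , J)`, and the part of `u` meeting `j` maps back to it up to a boundary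
      -- over `I ∖ j`, where `ε` vanishes.
      ε-onto : ∀ {I J} → Enumerates I J → ∃ λ z → RelChain K[ I ] J (length J) z × ε J z ≡ 1ℚ
      ε-onto {I} ([] empty) = atom ⊥ 1ℚ , supp-mono (λ { refl → (∅-face K[ I ] , ∣⊥∣≡0 N) , [] }) (atom-supp ⊥ 1ℚ) , atom-at {N} ⊥ 1ℚ
      ε-onto {I} (_∷_ {j} {J} j∈I en) =
        u′ , keep-supp-∩ (meets? j) (λ { m (s , r) → s , m ∷ r }) cu , (begin
          ε J (∂[ J ] u′)                         ≡⟨ resp (residue-linear J) split-u ⊥ ⟩
          ε J (∂[ J ] u ⊖ ∂[ J ] (u ⊖ u′))        ≡⟨ linear-∸ (residue-linear J) (∂[ J ] u) (∂[ J ] (u ⊖ u′)) ⊥ ⟩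
          ε J (∂[ J ] u) - ε J (∂[ J ] (u ⊖ u′))  ≡⟨ cong₂ _-_ (trans (resp (residue-linear J) (proj₂ (proj₂ filling)) ⊥) (proj₂ (proj₂ IH))) (ε-∂[] en su″) ⟩
          1ℚ - 0ℚ                                 ≡⟨⟩
          1ℚ                                      ∎)
        where
        IH : ∃ λ z → RelChain K[ I ∖ j ] J (length J) z × ε J z ≡ 1ℚ
        IH = ε-onto en
        z : F N
        z = proj₁ IH
        cz : RelChain K[ I ∖ j ] J (length J) z
        cz = proj₁ (proj₂ IH)
        filling : ∃ λ u → RelChain K[ I ] J (suc (length J)) u × ∂[ J ] u ≗ z
        filling = rel-exact (enumerates⇒misses (p-x⊆p I j) j∈I (x∉p-x I j) en) (length J)
          (subst (λ k → length J ℕ.< k ℕ.+ m) (sym (enumerates-length (j∈I ∷ en))) (s≤s (ℕ.m≤m+n (length J) m)))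
          z (enlarge {I} {j} {J} cz) (∂[]-low {K[ I ∖ j ]} en (forget {K[ I ∖ j ]} {J} cz))
        u u′ : F N
        u = proj₁ filling
        cu : RelChain K[ I ] J (suc (length J)) u
        cu = proj₁ (proj₂ filling)
        u′ = keep (meets? j) u
        split-u : ∂[ J ] u′ ≗ ∂[ J ] u ⊖ ∂[ J ] (u ⊖ u′)
        split-u τ = trans (resp (∂[]-linear J) {y = u ⊖ (u ⊖ u′)} (λ σ → solve 2 (λ p q → p := q :- (q :- p)) refl (u′ σ) (u σ)) τ)
                      (linear-∸ (∂[]-linear J) u (u ⊖ u′) τ)
        su″ : Supp (_⊆ ⋃[ I ∖ j ] V) (u ⊖ u′)
        su″ = drop-supp-∩ (meets? j) {R = _⊆ ⋃[ I ∖ j ] V} (λ { ¬m (((_ , σ⊆) , _) , _) → ⋃-avoid σ⊆ ¬m }) cu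

-- Comparison with the order complex

∈-subsets : ∀ (σ : Subset N) → σ ∈ˡ subsets N
∈-subsets []            = here refl
∈-subsets (outside ∷ σ) = ∈-++⁺ˡ (∈-map⁺ (outside ∷_) (∈-subsets σ))
∈-subsets {suc N} (inside ∷ σ) = ∈-++⁺ʳ (map (outside ∷_) (subsets N)) (∈-map⁺ (inside ∷_) (∈-subsets σ))

subsets-unique : ∀ N → Unique (subsets N)
subsets-unique zero    = [] ∷ []
subsets-unique (suc N) = Unique.++⁺
  (Unique.map⁺ ∷-injectiveʳ (subsets-unique N)) (Unique.map⁺ ∷-injectiveʳ (subsets-unique N))
  λ { (σ∈ₒ , σ∈ᵢ) → disjoint-heads (∈-map⁻ (outside ∷_) σ∈ₒ) (∈-map⁻ (inside ∷_) σ∈ᵢ) }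
  where
  disjoint-heads : ∀ {σ} → (∃ λ τ → τ ∈ˡ subsets N × σ ≡ outside ∷ τ) →
                   ¬ (∃ λ τ → τ ∈ˡ subsets N × σ ≡ inside ∷ τ)
  disjoint-heads (_ , _ , refl) (_ , _ , ())

lookup-injective : ∀ {A : Set} {xs : List A} → Unique xs → ∀ i j → lookup xs i ≡ lookup xs j → i ≡ j
lookup-injective (_  ∷ _) zero    zero    eq = refl
lookup-injective (x∉ ∷ _) zero    (suc j) eq = contradiction eq (All.lookup x∉ (∈-lookup j))
lookup-injective (x∉ ∷ _) (suc i) zero    eq = contradiction (sym eq) (All.lookup x∉ (∈-lookup i))
lookup-injective (_  ∷ u) (suc i) (suc j) eq = cong suc (lookup-injective u i j eq)

module _ {P : Pred (Fin L) 0ℓ} (P? : Decidable P) where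

  comprehension : Subset L
  comprehension = tabulate (does ∘ P?)

  ∈-comprehension⁺ : ∀ {i} → P i → i ∈ comprehension
  ∈-comprehension⁺ {i} p = lookup⇒[]= i _ (trans (lookup∘tabulate (does ∘ P?) i) (dec-true (P? i) p))

  ∈-comprehension⁻ : ∀ {i} → i ∈ comprehension → P i
  ∈-comprehension⁻ {i} i∈ with P? i | trans (sym (lookup∘tabulate (does ∘ P?) i)) ([]=⇒lookup i∈)
  ... | yes p | _ = p

wedge-chain : ∀ (K : Complex N) v {d x} → (∀ τ → Face K τ → Face K (insert v τ)) →
              IsChain K d x → IsChain K (suc d) (wedge v x)
wedge-chain K v cone = wedge-supp v λ { τ v∉τ (Kτ , ∣τ∣≡) → cone τ Kτ , trans (∣insert∣ v τ v∉τ) (cong suc ∣τ∣≡) }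

∂-chain : ∀ (K : Complex N) {d x} → IsChain K (suc d) x → IsChain K d (∂ x)
∂-chain K = ∂-supp λ { τ v v∉τ (Kσ , ∣σ∣≡) →
  ⊆-closed K (⊆-insert v τ) Kσ , ℕ.suc-injective (trans (sym (∣insert∣ v τ v∉τ)) ∣σ∣≡) }

∣σ∣≡0⇒σ≡⊥ : ∀ {σ : Subset N} → ∣ σ ∣ ≡ 0 → σ ≡ ⊥
∣σ∣≡0⇒σ≡⊥ ∣σ∣≡0 = Empty-unique λ { (_ , v∈σ) → contradiction (trans (sym ∣σ∣≡0) (∣p-x∣ v∈σ)) λ () }

∂-atom-⊥ : ∀ q → ∂ (atom {N} ⊥ q) ≗ 𝟎
∂-atom-⊥ q τ = trans (∂-local (atom ⊥ q) 𝟎 τ λ v _ → atom-supp ⊥ q _ λ eq → ∉⊥ (subst (v ∈_) eq (∈-insert v τ)))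
  (linear-0 ∂-linear τ)

-- The augmented cellular complex of colorful simplices.

module Comparison {N n : ℕ} (C : Complex N) (V : Partition C n) where

  open Relative V

  J : List (Fin n)
  J = proj₁ (enumeration ⊤)

  J-all : Enumerates ⊤ J
  J-all = proj₂ (enumeration ⊤)

  -- The list from which `Col C V` is built, so indices into it are the vertices of that complex.
  σs : List (Subset N)
  σs = filter (colorful? C V) (subsets N)

  s : Fin (length σs) → Subset N
  s = lookup σs

  s-injective : ∀ {i j} → s i ≡ s j → i ≡ j
  s-injective = lookup-injective (Unique.filter⁺ (colorful? C V) (subsets-unique N)) _ _

  s-colorful : ∀ i → Colorful C V (s i)
  s-colorful i = proj₂ (∈-filter⁻ (colorful? C V) {xs = subsets N} (∈-lookup i))

  s-surjective : ∀ {σ} → Colorful C V σ → ∃ λ i → s i ≡ σ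
  s-surjective {σ} cσ = Any.index σ∈ , sym (lookup-index σ∈)
    where
    σ∈ : σ ∈ˡ σs
    σ∈ = ∈-filter⁺ (colorful? C V) (∈-subsets σ) cσ

  rainbow⇒meets : ∀ {σ} → Rainbow J σ → ∀ i → Meets i σ
  rainbow⇒meets r i = All.lookup r (enumerates-⊇ J-all ∈⊤)

  s-rainbow : ∀ i → Rainbow J (s i)
  s-rainbow i = All.universal (proj₂ (s-colorful i)) J

  s-size : ∀ i → length J ℕ.≤ ∣ s i ∣
  s-size i = rainbow-length J-all (s-rainbow i)

  face-⊆ : ∀ {σ} → Face C σ → σ ⊆ ⋃[ ⊤ ] V
  face-⊆ Cσ {v} v∈σ with Equivalence.to (covers V v) (⊆-closed C (λ u∈ → subst (_∈ _) (sym (x∈⁅y⁆⇒x≡y v u∈)) v∈σ) Cσ)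
  ... | i , v∈i = class-∈ ∈⊤ v∈i

  -- In degree e: the colorful simplices with |J| + e - 2 vertices, and, for e ≡ 1,
  -- the augmentation cell inside ∷ ⊥.
  ColorfulCell : Subset (length σs) → ℕ → Pred (Subset N) 0ℓ
  ColorfulCell Q e σ = (∃ λ i → i ∈ Q × s i ≡ σ) × 2 ℕ.+ ∣ σ ∣ ≡ length J ℕ.+ e

  Cell : Subset (length σs) → ℕ → Pred (Subset (suc N)) 0ℓ
  Cell Q e (outside ∷ σ) = ColorfulCell Q e σ
  Cell Q e (inside  ∷ σ) = σ ≡ ⊥ × e ≡ 1

  -- The cellular boundary with `ε` as augmentation. The augmentation cell has boundary zero, so its
  -- coefficient in `x` does not enter.
  b : F (suc N) → F (suc N)
  b x = join (∂[ J ] (x ∘ (outside ∷_))) (atom ⊥ (ε J (x ∘ (outside ∷_))))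

  outside-linear : Linear {suc N} {N} (_∘ (outside ∷_))
  resp outside-linear x≗y σ = x≗y (outside ∷ σ)
  comb outside-linear a b x y σ = refl

  atom-linear : ∀ {M M′} {f : F M → F M′} τ → Linear f → Linear {M} {M′} (λ x → atom τ (f x τ))
  resp (atom-linear τ lf) x≗y σ with does (σ ≟ˢ τ)
  ... | true  = resp lf x≗y τ
  ... | false = refl
  comb (atom-linear τ lf) a b x y σ with does (σ ≟ˢ τ)
  ... | true  = comb lf a b x y τ
  ... | false = solve 2 (λ c d → con 0ℚ := c :* con 0ℚ :+ d :* con 0ℚ) refl a b

  b-linear : Linear b
  b-linear = join-linear (∘-linear (∂[]-linear J) outside-linear)
    (atom-linear ⊥ (∘-linear (residue-linear J) outside-linear))

  -- `δ-expand` recovers only the coefficients of colorful cells; this lets `b` be computed from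
  -- them.
  b-cong : ∀ (x y : F (suc N)) → x ∘ (outside ∷_) ≗ y ∘ (outside ∷_) → b x ≗ b y
  b-cong x y eq (outside ∷ σ) = resp (∂[]-linear J) eq σ
  b-cong x y eq (inside  ∷ σ) = cong (λ q → atom ⊥ q σ) (resp (residue-linear J) eq ⊥)

  Colorfully : Pred (F (suc N)) 0ℓ
  Colorfully x = Supp (λ σ → ∃ λ i → s i ≡ σ) (x ∘ (outside ∷_))

  colorful-face : ∀ {τ i v} → Rainbow J τ → s i ≡ insert v τ → ∃ λ k → s k ≡ τ
  colorful-face {τ} {i} {v} r eq = s-surjective
    (⊆-closed C (⊆-insert v τ) (subst (Face C) eq (proj₁ (s-colorful i))) , rainbow⇒meets r)

  b-colorfully : ∀ x → Colorfully x → Colorfully (b x)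
  b-colorfully x sx = keep-supp-∩ (rainbow? J) (λ { r (i , v , eq) → colorful-face r eq })
    (∂-supp (λ { τ v v∉τ (i , eq) → i , v , eq }) sx)

  -- In the augmentation component this is the vanishing of `ε` on boundaries.
  bb≗0 : ∀ x → Colorfully x → b (b x) ≗ 𝟎
  bb≗0 x sx (outside ∷ σ) = ∂[]∂[]≗0 J (x ∘ (outside ∷_)) σ
  bb≗0 x sx (inside  ∷ σ) = trans (cong (λ q → atom ⊥ q σ) (ε-∂[] J-all
      (supp-mono {Q = _⊆ ⋃[ ⊤ ] V} (λ { (i , refl) → face-⊆ (proj₁ (s-colorful i)) }) sx)))
    (linear-0 (keep-linear (_≟ˢ ⊥)) σ)

  -- Generators and the subdivision map.

  δ : Fin (length σs) → F (suc N)
  δ i = atom (outside ∷ s i) 1ℚ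

  δ-colorfully : ∀ i → Colorfully (δ i)
  δ-colorfully i σ ¬∃ = atom-supp (outside ∷ s i) 1ℚ (outside ∷ σ) λ eq → ¬∃ (i , sym (∷-injectiveʳ eq))

  δ-expand : ∀ x → Colorfully x → x ∘ (outside ∷_) ≗ λ σ → sum λ i → x (outside ∷ s i) * δ i (outside ∷ σ)
  δ-expand x sx σ with Fin.any? (λ i → s i ≟ˢ σ)
  ... | yes (j , refl) = sym (trans
    (sum-single (λ i → x (outside ∷ s i) * δ i (outside ∷ s j)) j λ i i≢j →
      trans (cong (x (outside ∷ s i) *_) (atom-supp (outside ∷ s i) 1ℚ (outside ∷ s j) (i≢j ∘ sym ∘ s-injective ∘ ∷-injectiveʳ)))
        (ℚ.*-zeroʳ (x (outside ∷ s i))))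
    (trans (cong (x (outside ∷ s j) *_) (atom-at (outside ∷ s j) 1ℚ)) (ℚ.*-identityʳ (x (outside ∷ s j)))))
  ... | no ¬∃ = trans (sx σ ¬∃) (sym (sum-zero (λ i → x (outside ∷ s i) * δ i (outside ∷ σ)) λ i →
      trans (cong (x (outside ∷ s i) *_) (δ-colorfully i σ λ { (k , eq) → ¬∃ (k , eq) }))
        (ℚ.*-zeroʳ (x (outside ∷ s i)))))

  b-expand : ∀ x → Colorfully x → b x ≗ λ c → sum λ i → x (outside ∷ s i) * b (δ i) c
  b-expand x sx c = trans (b-cong x (λ c → sum λ i → x (outside ∷ s i) * δ i c) (δ-expand x sx) c) (linear-sum b-linear (λ i → x (outside ∷ s i)) δ c)

  -- The recursion is on the degree, since `b (δ i)` lies one degree below the cell `i`. The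
  -- augmentation cell, of degree 1, goes to the empty simplex, of degree 0, so the map lowers
  -- degrees by one.
  Φ : ℕ → F (suc N) → F (length σs)
  Φ zero          y = 𝟎
  Φ (suc zero)    y = atom ⊥ (y (inside ∷ ⊥))
  Φ (suc (suc e)) y S = sum λ i → y (outside ∷ s i) * wedge i (Φ (suc e) (b (δ i))) S

  Φ-linear : ∀ e → Linear (Φ e)
  Φ-linear zero          = 0-linear
  resp (Φ-linear (suc zero)) x≗y S = cong (λ q → atom ⊥ q S) (x≗y (inside ∷ ⊥))
  comb (Φ-linear (suc zero)) a b x y S with does (S ≟ˢ ⊥)
  ... | true  = refl
  ... | false = solve 2 (λ c d → con 0ℚ := c :* con 0ℚ :+ d :* con 0ℚ) refl a b
  resp (Φ-linear (suc (suc e))) x≗y S = sum-cong-≗ λ i → cong (_* wedge i (Φ (suc e) (b (δ i))) S) (x≗y (outside ∷ s i))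
  comb (Φ-linear (suc (suc e))) a b′ x y S = trans
    (sum-cong-≗ λ i → solve 5 (λ a b p q w → (a :* p :+ b :* q) :* w := a :* (p :* w) :+ b :* (q :* w)) refl
      a b′ (x (outside ∷ s i)) (y (outside ∷ s i)) (wedge i (Φ (suc e) (b (δ i))) S))
    (sum-linear (λ i → x (outside ∷ s i) * wedge i (Φ (suc e) (b (δ i))) S) (λ i → y (outside ∷ s i) * wedge i (Φ (suc e) (b (δ i))) S) a b′)

  -- By induction the image of the boundary of each cell is a cycle, hence equals the boundary of
  -- its cone; linearity then gives all `y`.
  ∂Φ : ∀ e y → Colorfully y → ∂ (Φ (suc e) y) ≗ Φ e (b y)
  ∂Φ zero    y sy = ∂-atom-⊥ (y (inside ∷ ⊥))
  ∂Φ (suc e) y sy S = begin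
    ∂ (Φ (suc (suc e)) y) S
      ≡⟨ linear-sum ∂-linear c (λ i → wedge i (φ i)) S ⟩
    sum (λ i → c i * ∂ (wedge i (φ i)) S)
      ≡⟨ sum-cong-≗ (λ i → cong (c i *_) (wedge-fills i (λ T → trans (∂Φ e (b (δ i)) (b-colorfully (δ i) (δ-colorfully i)) T) (trans (resp (Φ-linear e) (bb≗0 (δ i) (δ-colorfully i)) T) (linear-0 (Φ-linear e) T))) S)) ⟩
    sum (λ i → c i * φ i S)
      ≡⟨ linear-sum (Φ-linear (suc e)) c (b ∘ δ) S ⟨
    Φ (suc e) (λ τ → sum λ i → c i * b (δ i) τ) S
      ≡⟨ resp (Φ-linear (suc e)) (b-expand y sy) S ⟨
    Φ (suc e) (b y) S ∎
    where
    c : Fin (length σs) → ℚ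
    c i = y (outside ∷ s i)
    φ : Fin (length σs) → F (length σs)
    φ i = Φ (suc e) (b (δ i))

  -- Down-closed sets of cells.

  Col[_] : Subset (length σs) → Complex (length σs)
  Col[ Q ] = Col C V [[ Q ]]

  Cells : Subset (length σs) → ℕ → Pred (F (suc N)) 0ℓ
  Cells Q e = Supp (Cell Q e)

  DownClosed : Subset (length σs) → Set
  DownClosed Q = ∀ i j → s i ⊆ s j → j ∈ Q → i ∈ Q

  cells-colorfully : ∀ {Q e x} → Cells Q e x → Colorfully x
  cells-colorfully cx σ ¬∃ = cx (outside ∷ σ) λ { ((i , _ , eq) , _) → ¬∃ (i , eq) }

  module _ {Q : Subset (length σs)} (down : DownClosed Q) where

    b-cells : ∀ {e x} → Cells Q (suc e) x → Cells Q e (b x)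
    b-cells {e} {x} cx (outside ∷ τ) ¬cell = keep-supp-∩ (rainbow? J) {R = ColorfulCell Q e} face
        (∂-supp {Q = λ τ → ∃ λ v → v ∉ τ × ColorfulCell Q (suc e) (insert v τ)} (λ τ v v∉τ cell → v , v∉τ , cell) (cx ∘ (outside ∷_))) τ ¬cell
      where
      face : ∀ {τ} → Rainbow J τ → (∃ λ v → v ∉ τ × ColorfulCell Q (suc e) (insert v τ)) → ColorfulCell Q e τ
      face {τ} r (v , v∉τ , (i , i∈Q , eq) , size) with k , refl ← colorful-face r eq =
        (k , down k i (subst (s k ⊆_) (sym eq) (⊆-insert v (s k))) i∈Q , refl) ,
        ℕ.suc-injective (trans (cong (2 ℕ.+_) (sym (∣insert∣ v (s k) v∉τ))) (trans size (ℕ.+-suc (length J) e)))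
    b-cells {e} {x} cx (inside ∷ σ) ¬cell with σ ≟ˢ ⊥
    -- Off `⊥` the point mass is zero. At `⊥`, a nonzero `ε` needs a simplex with `length J`
    -- vertices, which is a cell of degree 2, so `e` is 1.
    ... | no  _   = refl
    ... | yes σ≡⊥ = ε-degree J λ τ ¬≢ → cx (outside ∷ τ) λ { (_ , size) → ¬≢ λ ∣τ∣≡ → ¬cell (σ≡⊥ ,
          ℕ.+-cancelˡ-≡ (length J) e 1 (ℕ.suc-injective (trans (sym (ℕ.+-suc (length J) e)) (trans (sym size)
            (cong suc (trans (cong suc ∣τ∣≡) (ℕ.+-comm 1 (length J)))))))) }

  below : Fin (length σs) → Subset (length σs)
  below i = comprehension (λ j → s j ⊆? s i)

  ∈-below⁺ : ∀ {i j} → s j ⊆ s i → j ∈ below i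
  ∈-below⁺ {i} = ∈-comprehension⁺ (λ j → s j ⊆? s i)

  ∈-below⁻ : ∀ {i j} → j ∈ below i → s j ⊆ s i
  ∈-below⁻ {i} = ∈-comprehension⁻ (λ j → s j ⊆? s i)

  below-down : ∀ i → DownClosed (below i)
  below-down i k j k⊆j j∈ = ∈-below⁺ {i} {k} (⊆-trans k⊆j (∈-below⁻ {i} {j} j∈))

  Maximal : Subset (length σs) → Fin (length σs) → Set
  Maximal Q i = ∀ j → j ∈ Q → s i ⊆ s j → s j ⊆ s i

  remove-down : ∀ {Q i} → DownClosed Q → Maximal Q i → DownClosed (Q ∖ i)
  remove-down {Q} {i} down max k j k⊆j j∈ = x∈p∧x≢y⇒x∈p-y (down k j k⊆j (p-x⊆p Q i j∈))
    λ { refl → ∈-p-x⁻ Q j∈ (s-injective (⊆-antisym (max j (p-x⊆p Q i j∈) k⊆j) k⊆j)) }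

  below-maximal : ∀ i → Maximal (below i) i
  below-maximal i j j∈ _ = ∈-below⁻ {i} {j} j∈

  -- A boundary never contains the simplex itself, so what remains lies strictly below `i`, where
  -- the induction for `Φ` applies.
  b-δ : ∀ {e} i → 2 ℕ.+ ∣ s i ∣ ≡ length J ℕ.+ suc e → Cells (below i ∖ i) e (b (δ i))
  b-δ {e} i size = supp-∩ {P = Cell (below i) e} {Q = λ c → c ≢ outside ∷ s i} shrink
      (b-cells (below-down i) δ-cells) avoid
    where
    δ-cells : Cells (below i) (suc e) (δ i)
    δ-cells = supp-mono (λ { refl → (i , ∈-below⁺ {i} {i} id , refl) , size }) (atom-supp (outside ∷ s i) 1ℚ)
    shrink : ∀ {c} → Cell (below i) e c → c ≢ outside ∷ s i → Cell (below i ∖ i) e c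
    shrink {outside ∷ σ} ((k , k∈ , refl) , size) c≢ = (k , x∈p∧x≢y⇒x∈p-y k∈ (λ { refl → c≢ refl }) , refl) , size
    shrink {inside ∷ σ}  cell c≢ = cell
    avoid : Supp (λ c → c ≢ outside ∷ s i) (b (δ i))
    avoid c ¬≢ with c ≟ˢ (outside ∷ s i)
    ... | no  c≢   = contradiction c≢ ¬≢
    ... | yes refl = trans (keep-yes (rainbow? J) (∂ (δ i ∘ (outside ∷_))) (s i) (s-rainbow i))
      (trans (∂-local (δ i ∘ (outside ∷_)) 𝟎 (s i) λ v v∉ → atom-supp (outside ∷ s i) 1ℚ (outside ∷ insert v (s i))
        λ eq → v∉ (subst (v ∈_) (∷-injectiveʳ eq) (∈-insert v (s i)))) (linear-0 ∂-linear (s i)))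

  chain-insert : ∀ {i} T → Face (Col C V) T → (∀ {j} → j ∈ T → s j ⊆ s i) → Face (Col C V) (insert i T)
  chain-insert {i} T chain ⊆i k k∈ j j∈ with ∈-insert⁻ i T k∈ | ∈-insert⁻ i T j∈
  ... | inj₁ refl | inj₁ refl = inj₁ id
  ... | inj₁ refl | inj₂ j∈T  = inj₂ (⊆i j∈T)
  ... | inj₂ k∈T  | inj₁ refl = inj₁ (⊆i k∈T)
  ... | inj₂ k∈T  | inj₂ j∈T  = chain k k∈T j j∈T

  -- Inductively the boundary of a cell is subdivided inside the chains strictly below `i`; adding
  -- `i` on top keeps a chain, of one more element.
  Φ-chain : ∀ e {Q y} → DownClosed Q → Cells Q (suc e) y → IsChain Col[ Q ] e (Φ (suc e) y)
  Φ-chain zero {Q} {y} down cy = supp-mono (λ { refl → ∅-face Col[ Q ] , ∣⊥∣≡0 (length σs) }) (atom-supp ⊥ (y (inside ∷ ⊥)))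
  Φ-chain (suc e) {Q} {y} down cy S ¬simplex = sum-zero _ term
    where
    term : ∀ i → y (outside ∷ s i) * wedge i (Φ (suc e) (b (δ i))) S ≡ 0ℚ
    term i with (i ∈? Q) ×-dec (2 ℕ.+ ∣ s i ∣ ℕ.≟ length J ℕ.+ suc (suc e))
    ... | no ¬cell = trans
      (cong (_* wedge i (Φ (suc e) (b (δ i))) S) (cy (outside ∷ s i) λ { ((k , k∈ , eq) , size) → ¬cell (subst (_∈ Q) (s-injective eq) k∈ , size) }))
      (ℚ.*-zeroˡ (wedge i (Φ (suc e) (b (δ i))) S))
    ... | yes (i∈Q , size) = trans
      (cong (y (outside ∷ s i) *_) (wedge-supp {x = Φ (suc e) (b (δ i))} i attach (Φ-chain e (remove-down (below-down i) (below-maximal i)) (b-δ i size)) S ¬simplex))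
      (ℚ.*-zeroʳ (y (outside ∷ s i)))
      where
      attach : ∀ T → i ∉ T → IsSimplex Col[ below i ∖ i ] e T → IsSimplex Col[ Q ] (suc e) (insert i T)
      attach T i∉T ((chain , T⊆) , ∣T∣≡) = (chain-insert T chain ⊆i , ⊆Q) , trans (∣insert∣ i T i∉T) (cong suc ∣T∣≡)
        where
        ⊆i : ∀ {j} → j ∈ T → s j ⊆ s i
        ⊆i {j} j∈T = ∈-below⁻ {i} {j} (p-x⊆p (below i) i (T⊆ j∈T))
        ⊆Q : insert i T ⊆ Q
        ⊆Q j∈ with ∈-insert⁻ i T j∈
        ... | inj₁ refl = i∈Q
        ... | inj₂ j∈T  = down _ i (⊆i j∈T) i∈Q

  -- A colorful simplex has at least `length J` vertices, so its degree is at least 2.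
  low-cells : ∀ {Q e x} → Cells Q e x → e ℕ.≤ 1 → x ∘ (outside ∷_) ≗ 𝟎
  low-cells {e = e} cx e≤1 σ = cx (outside ∷ σ) λ { ((i , _ , refl) , size) →
    ℕ.<-irrefl (sym size) (s≤s (ℕ.≤-trans (ℕ.+-monoʳ-≤ (length J) e≤1)
      (ℕ.≤-trans (ℕ.≤-reflexive (ℕ.+-comm (length J) 1)) (s≤s (s-size i))))) }

  -- Exactness over the set `Q` of colorful simplices of a subcomplex `K`.

  module _ {K : Complex N} {Q : Subset (length σs)}
           (K⊆C : ∀ {σ} → Face K σ → Face C σ)
           (Q⇒K : ∀ i → i ∈ Q → Face K (s i)) (K⇒Q : ∀ i → Face K (s i) → i ∈ Q) where

    open Acyclic K

    cell⇒rel : ∀ {e d σ} → length J ℕ.+ e ≡ 2 ℕ.+ d → ColorfulCell Q e σ → RelSimplex K[ ⊤ ] J d σ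
    cell⇒rel eq ((i , i∈Q , refl) , size) =
      ((Q⇒K i i∈Q , face-⊆ (proj₁ (s-colorful i))) , ℕ.suc-injective (ℕ.suc-injective (trans size eq))) , s-rainbow i

    rel⇒cell : ∀ {e d σ} → length J ℕ.+ e ≡ 2 ℕ.+ d → RelSimplex K[ ⊤ ] J d σ → ColorfulCell Q e σ
    rel⇒cell eq (((Kσ , _) , ∣σ∣≡) , r) with i , refl ← s-surjective (K⊆C Kσ , rainbow⇒meets r) =
      (i , K⇒Q i Kσ , refl) , trans (cong (2 ℕ.+_) ∣σ∣≡) (sym eq)

    rel-cells : ∀ {e d x} → length J ℕ.+ e ≡ 2 ℕ.+ d → RelChain K[ ⊤ ] J d x → Cells Q e (ιₒ x)
    rel-cells eq cx (outside ∷ σ) ¬cell = cx σ (¬cell ∘ rel⇒cell eq)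
    rel-cells eq cx (inside  ∷ σ) ¬cell = refl

    -- In degree 1 a multiple of the chain from `ε-onto` hits the augmentation cell. In degree
    -- `d + 2`, `b y` being zero makes `y` a relative cycle killed by `ε`, and `ε-exact` fills it.
    -- Both the whole of `C` and the faces of one colorful simplex serve as `K`.
    cells-exact : ∀ m → (∀ I → Nonempty I → ∀ d → d ℕ.< ∣ I ∣ ℕ.+ m → RelExact K[ I ] [] d) →
                  ∀ e → e ℕ.≤ suc m → ∀ y → Cells Q e y → b y ≗ 𝟎 → ∃ λ u → Cells Q (suc e) u × b u ≗ y
    cells-exact m exact zero e≤ y cy by≗0 = 𝟎 , supp-𝟎 , λ c → trans (linear-0 b-linear c) (sym (y≗0 c))
      where
      y≗0 : y ≗ 𝟎
      y≗0 (outside ∷ σ) = low-cells cy z≤n σ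
      y≗0 (inside  ∷ σ) = cy (inside ∷ σ) λ ()
    cells-exact m exact (suc zero) e≤ y cy by≗0 = ιₒ u , rel-cells (ℕ.+-comm (length J) 2) cu , bu≗y
      where
      q : ℚ
      q = y (inside ∷ ⊥)
      onto : ∃ λ z → RelChain K[ ⊤ ] J (length J) z × ε J z ≡ 1ℚ
      onto = ε-onto m exact J-all
      u : F N
      u σ = q * proj₁ onto σ
      cu : RelChain K[ ⊤ ] J (length J) u
      cu = supp-* q (proj₁ (proj₂ onto))
      bu≗y : b (ιₒ u) ≗ y
      bu≗y (outside ∷ σ) = trans (∂[]-low {K[ ⊤ ]} J-all (forget {K[ ⊤ ]} {J} cu) σ) (sym (low-cells cy (s≤s z≤n) σ))
      bu≗y (inside  ∷ σ) = trans
        (cong (λ p → atom ⊥ p σ) (trans (linear-* (residue-linear J) q (proj₁ onto) ⊥) (trans (cong (q *_) (proj₂ (proj₂ onto))) (ℚ.*-identityʳ q))))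
        (atom-≗ {x = y ∘ (inside ∷_)} (λ τ τ≢⊥ → cy (inside ∷ τ) (τ≢⊥ ∘ proj₁)) σ)
    cells-exact m exact (suc (suc d)) (s≤s d<m) y cy by≗0 = ιₒ w , rel-cells eq′ cw , bw≗y
      where
      eq : length J ℕ.+ suc (suc d) ≡ 2 ℕ.+ (length J ℕ.+ d)
      eq = trans (ℕ.+-suc (length J) (suc d)) (cong suc (ℕ.+-suc (length J) d))
      eq′ : length J ℕ.+ suc (suc (suc d)) ≡ 2 ℕ.+ suc (length J ℕ.+ d)
      eq′ = trans (ℕ.+-suc (length J) (suc (suc d))) (cong suc eq)
      yₒ : F N
      yₒ = y ∘ (outside ∷_)
      filling : ∃ λ w → RelChain K[ ⊤ ] J (suc (length J ℕ.+ d)) w × ∂[ J ] w ≗ yₒ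
      filling = ε-exact m exact J-all d d<m yₒ (λ σ ¬rel → cy (outside ∷ σ) (¬rel ∘ cell⇒rel eq))
        (λ σ → by≗0 (outside ∷ σ)) (trans (sym (atom-at {N} ⊥ (ε J yₒ))) (by≗0 (inside ∷ ⊥)))
      w : F N
      w = proj₁ filling
      cw : RelChain K[ ⊤ ] J (suc (length J ℕ.+ d)) w
      cw = proj₁ (proj₂ filling)
      εw≡0 : ε J w ≡ 0ℚ
      -- `w` has more than `length J` vertices per simplex, so its boundary creates no augmentation
      -- term.
      εw≡0 = ε-degree J (supp-mono (λ { ((_ , ∣σ∣≡) , _) ∣σ∣≡J →
        ℕ.<-irrefl (trans (sym ∣σ∣≡J) ∣σ∣≡) (s≤s (ℕ.m≤m+n (length J) d)) }) cw)
      bw≗y : b (ιₒ w) ≗ y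
      bw≗y (outside ∷ σ) = proj₂ (proj₂ filling) σ
      bw≗y (inside  ∷ σ) = trans (cong (λ q → atom ⊥ q σ) εw≡0)
        (trans (linear-0 (keep-linear (_≟ˢ ⊥)) σ) (sym (cy (inside ∷ σ) λ ())))

  -- The face of `s i` on the colors `I` contains a vertex `v` of color `k`, so it is a full simplex
  -- and coning with apex `v` contracts it.
  simplex-exact : ∀ i m I → Nonempty I → ∀ d → d ℕ.< ∣ I ∣ ℕ.+ m → RelExact (C [[ s i ]] [[ ⋃[ I ] V ]]) [] d
  simplex-exact i m I (k , k∈I) d _ z cz ∂z≗0 with v , v∈ ← proj₂ (s-colorful i) k
    with v∈s , v∈k ← x∈p∩q⁻ (s i) (class V k) v∈ =
    wedge v z , supp-mono (_, []) (wedge-chain K v {d} cone (supp-mono proj₁ cz)) , wedge-fills v ∂z≗0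
    where
    K : Complex N
    K = C [[ s i ]] [[ ⋃[ I ] V ]]
    insert-⊆ : ∀ {X} τ → v ∈ X → τ ⊆ X → insert v τ ⊆ X
    insert-⊆ τ v∈X τ⊆X u∈ with ∈-insert⁻ v τ u∈
    ... | inj₁ refl = v∈X
    ... | inj₂ u∈τ  = τ⊆X u∈τ
    cone : ∀ τ → Face K τ → Face K (insert v τ)
    cone τ ((_ , τ⊆s) , τ⊆I) =
      (⊆-closed C (insert-⊆ τ v∈s τ⊆s) (proj₁ (s-colorful i)) , insert-⊆ τ v∈s τ⊆s) , insert-⊆ τ (class-∈ k∈I v∈k) τ⊆I

  below-exact : ∀ i e y → Cells (below i) e y → b y ≗ 𝟎 → ∃ λ u → Cells (below i) (suc e) u × b u ≗ y
  below-exact i e = cells-exact {K = C [[ s i ]]} {Q = below i} proj₁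
    (λ j j∈ → proj₁ (s-colorful j) , ∈-below⁻ {i} {j} j∈) (λ j Kj → ∈-below⁺ {i} {j} (proj₂ Kj))
    -- A simplex satisfies the assumption for every `m`; the value `e` brings degree `e` into range.
    e (simplex-exact i e) e (ℕ.n≤1+n e)

  -- Cone and D are the mapping cone of Φ and its differential.
  Cone : Set
  Cone = Subset (length σs) ⊎ Subset (suc N) → ℚ

  D : ℕ → Cone → Cone
  D e x (inj₁ S) = ∂ (x ∘ inj₁) S - Φ e (x ∘ inj₂) S
  D e x (inj₂ c) = - b (x ∘ inj₂) c

  -- Both components carry the same `e`: a cell of degree `e` has dimension `e - 2`, a chain with
  -- `e` elements dimension `e - 1`, which is the shift of a mapping cone.
  record InCone (Q : Subset (length σs)) (e : ℕ) (x : Cone) : Set where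
    constructor _,_
    field
      chain : IsChain Col[ Q ] e (x ∘ inj₁)
      cells : Cells Q e (x ∘ inj₂)

  ConeExact : Subset (length σs) → ℕ → Set
  ConeExact Q e = ∀ x → InCone Q e x → D e x ≗ 𝟎 → ∃ λ w → InCone Q (suc e) w × D (suc e) w ≗ x

  -- Algebra of the mapping cone.

  D-⊕ : ∀ e x y → D e (x ⊕ y) ≗ D e x ⊕ D e y
  D-⊕ e x y (inj₁ S) = trans (cong₂ _-_ (linear-+ ∂-linear (x ∘ inj₁) (y ∘ inj₁) S) (linear-+ (Φ-linear e) (x ∘ inj₂) (y ∘ inj₂) S))
    (solve 4 (λ p q r t → (p :+ q) :- (r :+ t) := (p :- r) :+ (q :- t)) refl (∂ (x ∘ inj₁) S) (∂ (y ∘ inj₁) S) (Φ e (x ∘ inj₂) S) (Φ e (y ∘ inj₂) S))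
  D-⊕ e x y (inj₂ c) = trans (cong -_ (linear-+ b-linear (x ∘ inj₂) (y ∘ inj₂) c))
    (solve 2 (λ p q → :- (p :+ q) := (:- p) :+ (:- q)) refl (b (x ∘ inj₂) c) (b (y ∘ inj₂) c))

  D-resp : ∀ e {x y} → x ≗ y → D e x ≗ D e y
  D-resp e x≗y (inj₁ S) = cong₂ _-_ (resp ∂-linear (x≗y ∘ inj₁) S) (resp (Φ-linear e) (x≗y ∘ inj₂) S)
  D-resp e x≗y (inj₂ c) = cong -_ (resp b-linear (x≗y ∘ inj₂) c)

  D-⊖ : ∀ e x y → D e (x ⊖ y) ≗ D e x ⊖ D e y
  D-⊖ e x y p = begin
    D e (x ⊖ y) p                      ≡⟨ solve 2 (λ q r → q := (q :+ r) :- r) refl (D e (x ⊖ y) p) (D e y p) ⟩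
    (D e (x ⊖ y) p + D e y p) - D e y p ≡⟨ cong (_- D e y p) (D-⊕ e (x ⊖ y) y p) ⟨
    D e ((x ⊖ y) ⊕ y) p - D e y p      ≡⟨ cong (_- D e y p) (D-resp e (λ q → solve 2 (λ u v → (u :- v) :+ v := u) refl (x q) (y q)) p) ⟩
    D e x p - D e y p                  ∎

  DD≗0 : ∀ e {x} → Colorfully (x ∘ inj₂) → D e (D (suc e) x) ≗ 𝟎
  DD≗0 e {x} sx (inj₁ S) = begin
    ∂ (∂ z ⊖ Φ (suc e) y) S - Φ e (λ c → - b y c) S
      ≡⟨ cong₂ _-_ (linear-∸ ∂-linear (∂ z) (Φ (suc e) y) S) (linear-neg (Φ-linear e) (b y) S) ⟩
    (∂ (∂ z) S - ∂ (Φ (suc e) y) S) - (- Φ e (b y) S)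
      ≡⟨ cong₂ (λ p q → (p - q) - (- Φ e (b y) S)) (∂∂≗0 z S) (∂Φ e y sx S) ⟩
    (0ℚ - Φ e (b y) S) - (- Φ e (b y) S)
      ≡⟨ solve 1 (λ p → (con 0ℚ :- p) :- (:- p) := con 0ℚ) refl (Φ e (b y) S) ⟩
    0ℚ ∎
    where
    z : F (length σs)
    z = x ∘ inj₁
    y : F (suc N)
    y = x ∘ inj₂
  DD≗0 e {x} sx (inj₂ c) =
    cong -_ (trans (linear-neg b-linear (b (x ∘ inj₂)) c) (cong -_ (bb≗0 (x ∘ inj₂) sx c)))

  D-cone : ∀ {Q} → DownClosed Q → ∀ e {x} → InCone Q (suc e) x → InCone Q e (D (suc e) x)
  D-cone {Q} down e {x} (cz , cy) =
    supp-⊖ (∂-chain Col[ Q ] cz) (Φ-chain e down cy) , λ c ¬cell → cong -_ (b-cells down cy c ¬cell)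

  cone-⊕ : ∀ {Q e x y} → InCone Q e x → InCone Q e y → InCone Q e (x ⊕ y)
  cone-⊕ (cz , cy) (cz′ , cy′) = supp-⊕ cz cz′ , supp-⊕ cy cy′

  cone-⊖ : ∀ {Q e x y} → InCone Q e x → InCone Q e y → InCone Q e (x ⊖ y)
  cone-⊖ (cz , cy) (cz′ , cy′) = supp-⊖ cz cz′ , supp-⊖ cy cy′

  cone-mono : ∀ {Q Q′ e x} → Q ⊆ Q′ → InCone Q e x → InCone Q′ e x
  cone-mono {Q} {Q′} {e} {x} Q⊆ (cz , cy) =
    supp-mono {Q = IsSimplex Col[ Q′ ] e} (λ { ((chain , S⊆) , ∣S∣≡) → (chain , ⊆-trans S⊆ Q⊆) , ∣S∣≡ }) cz , supp-mono (λ {c} → cell {c}) cy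
    where
    cell : ∀ {c} → Cell Q e c → Cell Q′ e c
    cell {outside ∷ σ} ((i , i∈ , eq) , size) = (i , Q⊆ i∈ , eq) , size
    cell {inside  ∷ σ} c = c

  cone-neg : ∀ {Q e x} → InCone Q e x → InCone Q e (λ p → - x p)
  cone-neg (cz , cy) = (λ S ¬S → cong -_ (cz S ¬S)) , λ c ¬c → cong -_ (cy c ¬c)

  cone-resp : ∀ {Q e x y} → x ≗ y → InCone Q e x → InCone Q e y
  cone-resp x≗y (cz , cy) = supp-resp (x≗y ∘ inj₁) cz , supp-resp (x≗y ∘ inj₂) cy

  -- Places the common boundary of the two Mayer-Vietoris pieces in their intersection.
  cone-∩ : ∀ {Q Q′ i e x} → InCone Q e x → InCone (Q′ ∖ i) e x → InCone (Q ∖ i) e x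
  cone-∩ {Q} {Q′} {i} {e} {x} (cz , cy) (cz′ , cy′) =
    supp-∩ {R = IsSimplex Col[ Q ∖ i ] e} (λ { ((chain , S⊆) , ∣S∣≡) ((_ , S⊆′) , _) → (chain , λ j∈S → x∈p∧x≢y⇒x∈p-y (S⊆ j∈S) (∈-p-x⁻ Q′ (S⊆′ j∈S))) , ∣S∣≡ }) cz cz′ ,
    supp-∩ (λ {c} → cell {c}) cy cy′
    where
    cell : ∀ {c} → Cell Q e c → Cell (Q′ ∖ i) e c → Cell (Q ∖ i) e c
    cell {outside ∷ σ} ((j , j∈Q , refl) , size) ((k , k∈ , eq) , _) =
      (j , x∈p∧x≢y⇒x∈p-y j∈Q (subst (_≢ i) (s-injective eq) (∈-p-x⁻ Q′ k∈)) , refl) , size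
    cell {inside ∷ σ} c _ = c

  -- Exactness of the mapping cone.

  cone-exact-zero : ∀ Q → ConeExact Q 0
  cone-exact-zero Q x (cz , cy) _ = w , (supp-𝟎 , cw) , Dw≗x
    where
    z = x ∘ inj₁
    y′ : F (suc N)
    -- `Φ 1` takes the augmentation cell to the empty simplex; the sign cancels the minus before `Φ`
    -- in `D`.
    y′ = ιᵢ (atom ⊥ (- z ⊥))
    w : Cone
    w = [ 𝟎 , y′ ]′
    cw : Cells Q 1 y′
    cw (outside ∷ σ) ¬cell = refl
    cw (inside  ∷ σ) ¬cell = atom-supp ⊥ (- z ⊥) σ λ σ≡⊥ → ¬cell (σ≡⊥ , refl)
    Dw≗x : D 1 w ≗ x
    Dw≗x (inj₁ S) = begin
      ∂ 𝟎 S - atom ⊥ (atom {N} ⊥ (- z ⊥) ⊥) S  ≡⟨ cong₂ (λ p q → p - atom ⊥ q S) (linear-0 ∂-linear S) (atom-at {N} ⊥ (- z ⊥)) ⟩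
      0ℚ - atom ⊥ (- z ⊥) S                    ≡⟨ cong (λ q → 0ℚ - q) (atom-neg ⊥ (z ⊥) S) ⟩
      0ℚ - - atom ⊥ (z ⊥) S                    ≡⟨ solve 1 (λ p → con 0ℚ :- (:- p) := p) refl (atom ⊥ (z ⊥) S) ⟩
      atom ⊥ (z ⊥) S                           ≡⟨ atom-≗ (supp-mono (∣σ∣≡0⇒σ≡⊥ ∘ proj₂) cz) S ⟩
      z S                                      ∎
    Dw≗x (inj₂ (outside ∷ σ)) = trans (cong -_ (linear-0 (∂[]-linear J) σ)) (sym (low-cells cy z≤n σ))
    Dw≗x (inj₂ (inside  ∷ σ)) = trans
      (cong -_ (trans (cong (λ q → atom ⊥ q σ) (linear-0 (residue-linear J) ⊥)) (linear-0 (keep-linear (_≟ˢ ⊥)) σ)))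
      (sym (cy (inside ∷ σ) λ ()))

  -- The cell part is filled first, by `u`. Then `z ⊕ Φ (suc e) u` is a cycle among chains of
  -- elements below `i`, and coning with apex `i` fills it.
  cone-exact-below : ∀ i e → ConeExact (below i) e
  cone-exact-below i e x (cz , cy) Dx≗0 = [ w , u ]′ , (cw , cu) , Dw≗x
    where
    Q = below i
    z = x ∘ inj₁
    y = x ∘ inj₂
    by≗0 : b (λ c → - y c) ≗ 𝟎
    by≗0 c = trans (linear-neg b-linear y c) (Dx≗0 (inj₂ c))
    filling : ∃ λ u → Cells Q (suc e) u × b u ≗ λ c → - y c
    filling = below-exact i e (λ c → - y c) (λ c ¬cell → cong -_ (cy c ¬cell)) by≗0
    u : F (suc N)
    u = proj₁ filling
    cu : Cells Q (suc e) u
    cu = proj₁ (proj₂ filling)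
    t : F (length σs)
    t = z ⊕ Φ (suc e) u
    w : F (length σs)
    w = wedge i t
    Φbu : ∀ S → Φ e (b u) S ≡ - Φ e y S
    Φbu S = trans (resp (Φ-linear e) (proj₂ (proj₂ filling)) S) (linear-neg (Φ-linear e) y S)
    ∂t≗0 : ∂ t ≗ 𝟎
    ∂t≗0 S = begin
      ∂ t S                           ≡⟨ linear-+ ∂-linear z (Φ (suc e) u) S ⟩
      ∂ z S + ∂ (Φ (suc e) u) S       ≡⟨ cong (∂ z S +_) (trans (∂Φ e u (cells-colorfully cu) S) (Φbu S)) ⟩
      ∂ z S - Φ e y S                 ≡⟨ Dx≗0 (inj₁ S) ⟩
      0ℚ                              ∎
    cw : IsChain Col[ Q ] (suc e) w
    cw = wedge-chain Col[ Q ] i cone (supp-⊕ cz (Φ-chain e (below-down i) cu))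
      where
      cone : ∀ T → Face Col[ Q ] T → Face Col[ Q ] (insert i T)
      cone T (chain , T⊆) = chain-insert T chain (λ {j} j∈T → ∈-below⁻ {i} {j} (T⊆ j∈T)) , ⊆Q
        where
        ⊆Q : insert i T ⊆ Q
        ⊆Q j∈ with ∈-insert⁻ i T j∈
        ... | inj₁ refl = ∈-below⁺ {i} {i} id
        ... | inj₂ j∈T  = T⊆ j∈T
    Dw≗x : D (suc e) [ w , u ]′ ≗ x
    Dw≗x (inj₁ S) = trans (cong (_- Φ (suc e) u S) (wedge-fills i ∂t≗0 S))
      (solve 2 (λ p q → (p :+ q) :- q := p) refl (z S) (Φ (suc e) u S))
    Dw≗x (inj₂ c) = trans (cong -_ (proj₂ (proj₂ filling) c)) (solve 1 (λ p → :- (:- p) := p) refl (y c))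

  -- As `i` is maximal, every chain through `i` lies in `below i`. So `x` splits into `xB` over
  -- `below i` and `xA` over `Q ∖ i`, with opposite boundaries over the intersection `below i ∖ i`.
  -- A filling `w∩` of `D xB` there corrects both pieces to cycles, `xB ⊖ w∩` and `xA ⊕ w∩`.
  mayer-vietoris : ∀ {Q i} → DownClosed Q → Maximal Q i → i ∈ Q → ∀ e →
                   ConeExact (below i ∖ i) e → ConeExact (Q ∖ i) (suc e) → ConeExact Q (suc e)
  mayer-vietoris {Q} {i} down max i∈Q e exact∩ exactA x (cz , cy) Dx≗0 =
    wA ⊕ wB , cone-⊕ (cone-mono (p-x⊆p Q i) (proj₁ (proj₂ fillA))) (cone-mono below⊆Q (proj₁ (proj₂ fillB))) , Dw≗x
    where
    top? : Decidable (i ∈_)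
    top? S = i ∈? S
    cell? : Decidable (_≡ outside ∷ s i)
    cell? c = c ≟ˢ (outside ∷ s i)
    below⊆Q : below i ⊆ Q
    below⊆Q {j} j∈ = down j i (∈-below⁻ {i} {j} j∈) i∈Q
    xB xA : Cone
    xB = [ keep top? (x ∘ inj₁) , keep cell? (x ∘ inj₂) ]′
    xA = x ⊖ xB
    cB : InCone (below i) (suc e) xB
    cB = keep-supp-∩ top? star cz , keep-supp-∩ cell? cell cy
      where
      star : ∀ {S} → i ∈ S → IsSimplex Col[ Q ] (suc e) S → IsSimplex Col[ below i ] (suc e) S
      star {S} i∈S ((chain , S⊆) , ∣S∣≡) = (chain , S⊆below) , ∣S∣≡
        where
        S⊆below : S ⊆ below i
        S⊆below {j} j∈S with chain i i∈S j j∈S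
        ... | inj₁ i⊆j = ∈-below⁺ {i} {j} (max j (S⊆ j∈S) i⊆j)
        ... | inj₂ j⊆i = ∈-below⁺ {i} {j} j⊆i
      cell : ∀ {c} → c ≡ outside ∷ s i → Cell Q (suc e) c → Cell (below i) (suc e) c
      cell refl (_ , size) = (i , ∈-below⁺ {i} {i} id , refl) , size
    cA : InCone (Q ∖ i) (suc e) xA
    cA = drop-supp-∩ top? deletion cz , drop-supp-∩ cell? (λ {c} → cell {c}) cy
      where
      deletion : ∀ {S} → i ∉ S → IsSimplex Col[ Q ] (suc e) S → IsSimplex Col[ Q ∖ i ] (suc e) S
      deletion i∉S ((chain , S⊆) , ∣S∣≡) = (chain , λ j∈S → x∈p∧x≢y⇒x∈p-y (S⊆ j∈S) λ { refl → i∉S j∈S }) , ∣S∣≡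
      cell : ∀ {c} → c ≢ outside ∷ s i → Cell Q (suc e) c → Cell (Q ∖ i) (suc e) c
      cell {outside ∷ σ} c≢ ((j , j∈Q , refl) , size) = (j , x∈p∧x≢y⇒x∈p-y j∈Q (λ { refl → c≢ refl }) , refl) , size
      cell {inside  ∷ σ} c≢ c = c
    DA+DB : ∀ p → D (suc e) xA p ≡ - D (suc e) xB p
    DA+DB p = trans (D-⊖ (suc e) x xB p) (trans (cong (_- D (suc e) xB p) (Dx≗0 p)) (ℚ.+-identityˡ (- D (suc e) xB p)))
    c∩ : InCone (below i ∖ i) e (D (suc e) xB)
    c∩ = cone-∩ (D-cone (below-down i) e cB)
      (cone-resp (λ p → trans (cong -_ (DA+DB p)) (solve 1 (λ q → :- (:- q) := q) refl (D (suc e) xB p)))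
        (cone-neg (D-cone (remove-down down max) e cA)))
    fill∩ : ∃ λ w → InCone (below i ∖ i) (suc e) w × D (suc e) w ≗ D (suc e) xB
    fill∩ = exact∩ (D (suc e) xB) c∩ (DD≗0 e {xB} (cells-colorfully (InCone.cells cB)))
    w∩ : Cone
    w∩ = proj₁ fill∩
    fillB : ∃ λ w → InCone (below i) (suc (suc e)) w × D (suc (suc e)) w ≗ xB ⊖ w∩
    fillB = cone-exact-below i (suc e) (xB ⊖ w∩) (cone-⊖ cB (cone-mono (p-x⊆p (below i) i) (proj₁ (proj₂ fill∩))))
      λ p → trans (D-⊖ (suc e) xB w∩ p) (trans (cong (λ q → D (suc e) xB p - q) (proj₂ (proj₂ fill∩) p)) (ℚ.+-inverseʳ (D (suc e) xB p)))
    fillA : ∃ λ w → InCone (Q ∖ i) (suc (suc e)) w × D (suc (suc e)) w ≗ xA ⊕ w∩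
    fillA = exactA (xA ⊕ w∩) (cone-⊕ cA (cone-mono (-x-mono i below⊆Q) (proj₁ (proj₂ fill∩))))
      λ p → trans (D-⊕ (suc e) xA w∩ p) (trans (cong₂ _+_ (DA+DB p) (proj₂ (proj₂ fill∩) p)) (ℚ.+-inverseˡ (D (suc e) xB p)))
    wA wB : Cone
    wA = proj₁ fillA
    wB = proj₁ fillB
    Dw≗x : D (suc (suc e)) (wA ⊕ wB) ≗ x
    Dw≗x p = trans (D-⊕ (suc (suc e)) wA wB p) (trans (cong₂ _+_ (proj₂ (proj₂ fillA) p) (proj₂ (proj₂ fillB) p))
      (solve 3 (λ x y w → ((x :- y) :+ w) :+ (y :- w) := x) refl (x p) (xB p) (w∩ p)))

  maximal-exists : ∀ Q → Nonempty Q → ∃ λ i → i ∈ Q × Maximal Q i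
  maximal-exists Q (i , i∈Q) = climb N i i∈Q (ℕ.m≤m+n N ∣ s i ∣)
    where
    -- `k` bounds how many vertices `s i` lacks, and each climb adds at least one.
    climb : ∀ k i → i ∈ Q → N ℕ.≤ k ℕ.+ ∣ s i ∣ → ∃ λ i → i ∈ Q × Maximal Q i
    climb k i i∈Q N≤ with Fin.any? (λ j → j ∈? Q ×-dec s i ⊂? s j)
    ... | no ¬∃ = i , i∈Q , λ j j∈Q i⊆j {x} x∈j → decidable-stable (x ∈? s i) λ x∉i → ¬∃ (j , j∈Q , i⊆j , x , x∈j , x∉i)
    climb zero    i i∈Q N≤ | yes (j , j∈Q , i⊂j) = contradiction (∣p∣≤n (s j)) (ℕ.<⇒≱ (ℕ.≤-trans (s≤s N≤) (p⊂q⇒∣p∣<∣q∣ i⊂j)))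
    climb (suc k) i i∈Q N≤ | yes (j , j∈Q , i⊂j) = climb k j j∈Q (ℕ.≤-trans N≤
      (ℕ.≤-trans (ℕ.≤-reflexive (sym (ℕ.+-suc k ∣ s i ∣))) (ℕ.+-monoʳ-≤ k (p⊂q⇒∣p∣<∣q∣ i⊂j))))

  -- Only the augmentation cell, in degree 1, can carry a coefficient, and `Φ` maps it injectively
  -- to the empty simplex, so a cycle is zero.
  cone-exact-empty : ∀ {Q} → Empty Q → ∀ e → ConeExact Q (suc e)
  cone-exact-empty {Q} empty e x (cz , cy) Dx≗0 = 𝟎 , (supp-𝟎 , supp-𝟎) , λ p → trans (D𝟎 p) (sym (x≗0 p))
    where
    z≗0 : x ∘ inj₁ ≗ 𝟎
    z≗0 S = cz S λ { ((_ , S⊆) , ∣S∣≡) → nonempty-size S (λ { (j , j∈S) → empty (j , S⊆ j∈S) }) ∣S∣≡ }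
      where
      nonempty-size : ∀ S → Empty S → ∣ S ∣ ≢ suc e
      nonempty-size S ¬ne ∣S∣≡ = contradiction (trans (sym (∣⊥∣≡0 (length σs))) (trans (cong ∣_∣ (sym (Empty-unique ¬ne))) ∣S∣≡)) λ ()
    y-⊥ : ∀ e → suc e ≡ 1 → D (suc e) x (inj₁ ⊥) ≡ 0ℚ → x (inj₂ (inside ∷ ⊥)) ≡ 0ℚ
    y-⊥ zero refl eq = begin
      q                        ≡⟨ atom-at {length σs} ⊥ q ⟨
      φ                        ≡⟨ solve 1 (λ p → p := con 0ℚ :- (con 0ℚ :- p)) refl φ ⟩
      0ℚ - (0ℚ - φ)            ≡⟨ cong (λ r → 0ℚ - (r - φ)) (trans (resp ∂-linear z≗0 ⊥) (linear-0 (∂-linear {length σs}) ⊥)) ⟨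
      0ℚ - (∂ (x ∘ inj₁) ⊥ - φ) ≡⟨ cong (λ r → 0ℚ - r) eq ⟩
      0ℚ ∎
      where
      q φ : ℚ
      q = x (inj₂ (inside ∷ ⊥))
      φ = atom {length σs} ⊥ q ⊥
    x≗0 : x ≗ 𝟎
    x≗0 (inj₁ S)             = z≗0 S
    x≗0 (inj₂ (outside ∷ σ)) = cy (outside ∷ σ) λ { ((i , i∈Q , _) , _) → empty (i , i∈Q) }
    x≗0 (inj₂ (inside  ∷ σ)) with σ ≟ˢ ⊥ | suc e ℕ.≟ 1
    ... | no  σ≢⊥  | _       = cy (inside ∷ σ) (σ≢⊥ ∘ proj₁)
    ... | yes _    | no e≢1  = cy (inside ∷ σ) (e≢1 ∘ proj₂)
    ... | yes refl | yes e≡1 = y-⊥ e e≡1 (Dx≗0 (inj₁ ⊥))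
    D𝟎 : D (suc (suc e)) 𝟎 ≗ 𝟎
    D𝟎 (inj₁ S) = cong₂ _-_ (linear-0 ∂-linear S) (linear-0 (Φ-linear (suc (suc e))) S)
    D𝟎 (inj₂ c) = cong -_ (linear-0 b-linear c)

  cone-exact : ∀ Q → DownClosed Q → ∀ e → ConeExact Q e
  cone-exact Q down e = go ∣ Q ∣ Q ℕ.≤-refl down e
    where
    go : ∀ k Q → ∣ Q ∣ ℕ.≤ k → DownClosed Q → ∀ e → ConeExact Q e
    go k       Q ∣Q∣≤ down zero = cone-exact-zero Q
    go k       Q ∣Q∣≤ down (suc e) with nonempty? Q
    go k       Q ∣Q∣≤ down (suc e) | no empty = cone-exact-empty empty e
    go zero    Q ∣Q∣≤ down (suc e) | yes (i , i∈Q) = contradiction (ℕ.≤-trans (ℕ.≤-reflexive (sym (∣p-x∣ i∈Q))) ∣Q∣≤) λ ()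
    go (suc k) Q ∣Q∣≤ down (suc e) | yes ne with i , i∈Q , max ← maximal-exists Q ne =
      -- Both smaller sets are contained in `Q ∖ i`, so the bound on the cardinality decreases.
      mayer-vietoris down max i∈Q e
        (go k (below i ∖ i) (ℕ.≤-trans (p⊆q⇒∣p∣≤∣q∣ (-x-mono i λ {j} j∈ → down j i (∈-below⁻ {i} {j} j∈) i∈Q)) ∣Q-i∣≤) (remove-down (below-down i) (below-maximal i)) e)
        (go k (Q ∖ i) ∣Q-i∣≤ (remove-down down max) (suc e))
      where
      ∣Q-i∣≤ : ∣ Q ∖ i ∣ ℕ.≤ k
      ∣Q-i∣≤ = ℕ.s≤s⁻¹ (subst (ℕ._≤ suc k) (∣p-x∣ i∈Q) ∣Q∣≤)

  -- Acyclicity of the colorful complex.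

  module _ (m : ℕ) (exact : ∀ I → Nonempty I → ∀ d → d ℕ.< ∣ I ∣ ℕ.+ m → RelExact (C [[ ⋃[ I ] V ]]) [] d) where

    Col-vertex : ∃ (IsVertex (Col C V))
    Col-vertex with Fin.any? {length σs} {P = λ _ → Unit.⊤} (λ _ → yes tt)
    ... | yes (i , _) = i , λ j j∈ k k∈ → inj₁ (subst (λ l → s j ⊆ s l) (trans (x∈⁅y⁆⇒x≡y i j∈) (sym (x∈⁅y⁆⇒x≡y i k∈))) id)
    -- Without colorful simplices the chain with `ε` equal to 1 would be zero.
    ... | no ¬∃ = contradiction (trans (sym (proj₂ (proj₂ onto))) (trans (resp (residue-linear J) z≗0 ⊥) (linear-0 (residue-linear J) ⊥))) λ ()
      where
      onto : ∃ λ z → RelChain (C [[ ⋃[ ⊤ ] V ]]) J (length J) z × ε J z ≡ 1ℚ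
      onto = Acyclic.ε-onto C m exact J-all
      z≗0 : proj₁ onto ≗ 𝟎
      z≗0 σ = proj₁ (proj₂ onto) σ λ { (((Cσ , _) , _) , r) → ¬∃ (proj₁ (s-surjective (Cσ , rainbow⇒meets r)) , tt) }

    -- Exactness of the mapping cone makes `z` homologous to the image under `Φ` of a cellular
    -- cycle, up to sign; that cycle has degree at most `m + 1`, where the cellular complex is
    -- exact.
    Col-acyclic : H̃≡0-below (Col C V) (suc m)
    Col-acyclic zero    _        = Col-vertex
    Col-acyclic (suc d) (s≤s d<m) z cz ∂z≗0 = v , cv , ∂v≗z
      where
      e : ℕ
      e = suc d
      total : ∃ λ w → InCone ⊤ (suc e) w × D (suc e) w ≗ [ z , 𝟎 ]′
      total = cone-exact ⊤ (λ _ _ _ _ → ∈⊤) e [ z , 𝟎 ]′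
        (supp-mono {Q = IsSimplex Col[ ⊤ ] e} (λ { (chain , ∣S∣≡) → (chain , ⊆⊤) , ∣S∣≡ }) cz , supp-𝟎)
        λ { (inj₁ S) → cong₂ _-_ (∂z≗0 S) (linear-0 (Φ-linear e) S) ; (inj₂ c) → cong -_ (linear-0 b-linear c) }
      w : Cone
      w = proj₁ total
      cw : InCone ⊤ (suc e) w
      cw = proj₁ (proj₂ total)
      bw≗0 : b (w ∘ inj₂) ≗ 𝟎
      bw≗0 c = trans (solve 1 (λ p → p := :- (:- p)) refl (b (w ∘ inj₂) c)) (cong -_ (proj₂ (proj₂ total) (inj₂ c)))
      filling : ∃ λ u → Cells ⊤ (suc (suc e)) u × b u ≗ w ∘ inj₂
      filling = cells-exact {K = C} {Q = ⊤} id (λ i _ → proj₁ (s-colorful i)) (λ _ _ → ∈⊤)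
        m exact (suc e) (s≤s d<m) (w ∘ inj₂) (InCone.cells cw) bw≗0
      u : F (suc N)
      u = proj₁ filling
      v : F (length σs)
      -- Subtracting `Φ` of the filling `u` turns the term `Φ (w ∘ inj₂)` of `D w` into part of a
      -- boundary.
      v = (w ∘ inj₁) ⊖ Φ (suc (suc e)) u
      cv : IsChain (Col C V) (suc e) v
      cv = supp-mono (λ { ((chain , _) , ∣S∣≡) → chain , ∣S∣≡ })
        (supp-⊖ (InCone.chain cw) (Φ-chain (suc e) (λ _ _ _ _ → ∈⊤) (proj₁ (proj₂ filling))))
      ∂v≗z : ∂ v ≗ z
      ∂v≗z S = begin
        ∂ v S                                                ≡⟨ linear-∸ ∂-linear (w ∘ inj₁) (Φ (suc (suc e)) u) S ⟩
        ∂ (w ∘ inj₁) S - ∂ (Φ (suc (suc e)) u) S             ≡⟨ cong (λ q → ∂ (w ∘ inj₁) S - q) (∂Φ (suc e) u (cells-colorfully (proj₁ (proj₂ filling))) S) ⟩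
        ∂ (w ∘ inj₁) S - Φ (suc e) (b u) S                   ≡⟨ cong (λ q → ∂ (w ∘ inj₁) S - q) (resp (Φ-linear (suc e)) (proj₂ (proj₂ filling)) S) ⟩
        ∂ (w ∘ inj₁) S - Φ (suc e) (w ∘ inj₂) S              ≡⟨ proj₂ (proj₂ total) (inj₁ S) ⟩
        z S                                                  ∎

-- From `ηH` to vanishing homology and back.

ηH-≤⁻ : ∀ {e} (K : Complex N) → [ e ] ≤∞ ηH K → H̃≡0-below K e
ηH-≤⁻ {e = e} K e≤η with ηH K | ηH-isη K
ηH-≤⁻ K [ e≤k ]   | [ k ] | below , _ = λ d d<e → below d (ℕ.<-≤-trans d<e e≤k)
ηH-≤⁻ K (_ ≤⊤⁺)   | ⊤⁺    | below     = below _

ηH-≤⁺ : ∀ {e} (K : Complex N) → H̃≡0-below K e → [ e ] ≤∞ ηH K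
ηH-≤⁺ K below with ηH K | ηH-isη K
... | [ k ] | _ , max = [ max _ below ]
... | ⊤⁺    | _       = _ ≤⊤⁺

-- Makes the degrees uniform: in degree 0 vanishing means that a vertex exists, and that vertex
-- fills any multiple of the empty simplex.
H̃≡0⇒exact : ∀ {n} {C : Complex N} (V : Partition C n) (K : Complex N) d → H̃≡0 K d → Relative.RelExact V K [] d
H̃≡0⇒exact V K zero (v , Kv) z cz ∂z≗0 =
  wedge v z , wedge-supp v (λ { τ v∉τ ((_ , ∣τ∣≡0) , _) → ((subst (Face K ∘ insert v) (sym (∣σ∣≡0⇒σ≡⊥ ∣τ∣≡0)) (subst (Face K) (sym (insert-⊥ v)) Kv)) , trans (∣insert∣ v τ v∉τ) (cong suc ∣τ∣≡0)) , [] }) cz , wedge-fills v ∂z≗0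
H̃≡0⇒exact V K (suc d) H z cz ∂z≗0 with w , cw , ∂w≗z ← H z (supp-mono proj₁ cz) ∂z≗0 =
  w , supp-mono (_, []) cw , ∂w≗z

theorem2p3 : ∀ {N n : ℕ} (C : Complex N) (V : Partition C n) (m : ℕ) →
    (∀ (I : Subset n) → Nonempty I → [ ∣ I ∣ ℕ.+ m ] ≤∞ ηH (C [[ ⋃[ I ] V ]])) →
    [ m ℕ.+ 1 ] ≤∞ ηH (Col C V)
theorem2p3 C V m η≥ = ηH-≤⁺ (Col C V) (subst (H̃≡0-below (Col C V)) (ℕ.+-comm 1 m)
  (Comparison.Col-acyclic C V m λ I ne d d< →
    H̃≡0⇒exact V (C [[ ⋃[ I ] V ]]) d (ηH-≤⁻ (C [[ ⋃[ I ] V ]]) (η≥ I ne) d d<)))
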